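{- Let $g \ge 4$ and $r \ge 3$ be integers. Then $$\inf_{G \in G(g,r)}\frac{|\mathcal{M}(G)|}{|V(G)|} \ge \frac{1 - (r-1)^{ -\frac{r}{r-2}}}{2} - \frac{r (r-1)^{\lfloor \frac{g-2}{2} \rfloor}}{(\lfloor \frac{g-2}{2} \rfloor)!},$$ where $|\mathcal{M}(G)|$ denotes the cardinality of a maximum cardinality matching of $G$.
   Context: All graphs are finite, simple and undirected; $V(G)$ is the node set of $G$. The girth of a graph is the length of its shortest cycle. $G(g,r)$ is the family of all $r$-regular graphs (every node has degree exactly $r$) with girth at least $g$. A matching is a set of edges such that every node is incident to at most one of them. -}

module Defs where

open import Algebra.Bundles using (CommutativeRing)
open import Data.Bool.Base using (Bool; false; T)
open import Data.Bool.Properties using (T?)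
open import Data.Empty using (⊥)
open import Data.Fin.Base using (Fin)
import Data.Fin.Base as Fin
import Data.Fin.Properties as Fin
open import Data.Integer.Base using (ℤ; +_; -[1+_])
open import Data.List.Base
  using (List; []; _∷_; _++_; _∷ʳ_; allFin; cartesianProduct; filter; length; map)
open import Data.List.Extrema.Nat using (max)
open import Data.List.Relation.Unary.Linked using (Linked)
open import Data.List.Relation.Unary.Unique.Propositional using (Unique)
open import Data.Nat.Base as ℕ using (ℕ; zero; suc)
import Data.Nat.Properties as ℕ
open import Data.Product.Base using (_×_; _,_; ∃; ∃-syntax)
open import Data.Rational.Base
open import Data.Rational.Properties
import Data.Rational.Solver as ℚ-Solver
open import Data.Rational.Unnormalised.Base using (ℚᵘ)
import Data.Rational.Unnormalised.Base as ℚᵘ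
open import Data.Sum.Base using (_⊎_; inj₁; inj₂)
open import Function.Base using (case_of_)
open import Relation.Binary.Definitions using (tri<; tri≈; tri>)
open import Relation.Binary.PropositionalEquality
  using (_≡_; refl; sym; trans; cong; subst)
open import Relation.Nullary using (Dec; yes; no)
open import Relation.Nullary.Decidable using (_×-dec_; _⊎-dec_)

open import Algebra.Properties.Semiring.Exp
  (CommutativeRing.semiring +-*-commutativeRing) public using (_^_)

------------------------------------------------------------------------
-- Graphs

-- Up to isomorphism, a finite graph has node set Fin order.

record Graph : Set where
  field
    order  : ℕ
    adj    : Fin order → Fin order → Bool
    symm   : ∀ u v → adj u v ≡ adj v u
    irrefl : ∀ v → adj v v ≡ false

  V : Set
  V = Fin order

  _~_ : V → V → Set
  u ~ v = T (adj u v)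

  degree : V → ℕ
  degree v = length (filter (λ w → T? (adj v w)) (allFin order))

  Regular : ℕ → Set
  Regular r = ∀ v → degree v ≡ r

  -- v ∷ vs lists the nodes of a cycle in cyclic order.
  IsCycle : V → List V → Set
  IsCycle v vs = 3 ℕ.≤ length (v ∷ vs)
               × Unique (v ∷ vs)
               × Linked _~_ (v ∷ vs ∷ʳ v)

  -- An acyclic graph has infinite girth.
  Girth≥ : ℕ → Set
  Girth≥ g = ∀ v vs → IsCycle v vs → g ℕ.≤ length (v ∷ vs)

  -- Every edge occurs exactly once, with its smaller endpoint first.
  edges : List (V × V)
  edges = filter (λ (u , v) → (u Fin.<? v) ×-dec T? (adj u v))
                 (cartesianProduct (allFin order) (allFin order))

  Incident : V → V × V → Set
  Incident v (u , w) = v ≡ u ⊎ v ≡ w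

  incident? : ∀ v e → Dec (Incident v e)
  incident? v (u , w) = (v Fin.≟ u) ⊎-dec (v Fin.≟ w)

  IsMatching : List (V × V) → Set
  IsMatching es = ∀ v → length (filter (incident? v) es) ℕ.≤ 1

  isMatching? : ∀ es → Dec (IsMatching es)
  isMatching? es = Fin.all? λ v → length (filter (incident? v) es) ℕ.≤? 1

sublists : ∀ {A : Set} → List A → List (List A)
sublists []       = [] ∷ []
sublists (x ∷ xs) = sublists xs ++ map (x ∷_) (sublists xs)

-- Sublists of the duplicate-free list of edges represent sets of edges.

matchings : (G : Graph) → List (List (Graph.V G × Graph.V G))
matchings G = filter isMatching? (sublists edges) where open Graph G

matchingNumber : Graph → ℕ
matchingNumber G = max 0 (map length (matchings G))

-- The order is nonzero so that ratios with denominator |V(G)| make sense.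

record 𝒢 (g r : ℕ) : Set where
  field
    graph    : Graph
  open Graph graph public
  field
    nonEmpty : ℕ.NonZero order
    regular  : Regular r
    girth    : Girth≥ g

matchingRatio : ∀ {g r} → 𝒢 g r → ℚ
matchingRatio G = + matchingNumber graph / order
  where
  open 𝒢 G
  instance _ = nonEmpty

------------------------------------------------------------------------
-- Real numbers as two-sided Dedekind cuts

record ℝ : Set₁ where
  field
    L U        : ℚ → Set          -- L q means q < x; U q means x < q
    L-inhab    : ∃ L
    U-inhab    : ∃ U
    L-down     : ∀ {p q} → p < q → L q → L p
    U-up       : ∀ {p q} → p < q → U p → U q
    L-open     : ∀ {p} → L p → ∃[ q ] p < q × L q
    U-open     : ∀ {q} → U q → ∃[ p ] p < q × U p
    disjoint   : ∀ {q} → L q → U q → ⊥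
    located    : ∀ {p q} → p < q → L p ⊎ U q

-- Extended upper reals: the rationals strictly above a point of [-∞, ∞].
-- Unlike in ℝ, every family of rationals constructively has an infimum
-- here; the empty family has infimum ∞.

record UpperReal : Set₁ where
  field
    U      : ℚ → Set
    U-up   : ∀ {p q} → p < q → U p → U q
    U-open : ∀ {q} → U q → ∃[ p ] p < q × U p

inf : {I : Set} → (I → ℚ) → UpperReal
inf f = record
  { U      = λ q → ∃[ i ] f i < q
  ; U-up   = λ p<q (i , fi<p) → i , <-trans fi<p p<q
  ; U-open = λ (i , fi<q) → case <-dense fi<q of λ
      (p , fi<p , p<q) → p , p<q , i , fi<p
  }

infix 4 _≤ᴿ_

_≤ᴿ_ : ℝ → UpperReal → Set
x ≤ᴿ y = ∀ q → UpperReal.U y q → ℝ.U x q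

------------------------------------------------------------------------
-- Arithmetic

private
  open ℚ-Solver.+-*-Solver using (solve; _:+_; _:*_; _:-_; _:=_; con)

  q-[q-p] : ∀ q p → q - (q - p) ≡ p
  q-[q-p] = solve 2 (λ q p → q :- (q :- p) := p) refl

  [p-q]+q : ∀ p q → (p - q) + q ≡ p
  [p-q]+q = solve 2 (λ p q → (p :- q) :+ q := p) refl

  ½+½ : ∀ p → ½ * p + ½ * p ≡ p
  ½+½ = solve 1 (λ p → con ½ :* p :+ con ½ :* p := p) refl

  sub-anti : ∀ q {a b} → a < b → q - b < q - a
  sub-anti q a<b = +-monoʳ-< q (neg-antimono-< a<b)

  sub-mono : ∀ q {a b} → a < b → a - q < b - q
  sub-mono q = +-monoˡ-< (- q)

  half-mono : ∀ {a b} → a < b → ½ * a < ½ * b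
  half-mono = *-monoʳ-<-pos ½

  dbl-mono : ∀ {a b} → a < b → a + a < b + b
  dbl-mono a<b = +-mono-< a<b a<b

infixl 6 _ℚ-_ _-ℚ_
infixl 7 _/2

_ℚ-_ : ℚ → ℝ → ℝ
c ℚ- x = record
  { L        = λ q → U (c - q)
  ; U        = λ q → L (c - q)
  ; L-inhab  = case U-inhab of λ (u , Uu) → c - u , subst U (sym (q-[q-p] c u)) Uu
  ; U-inhab  = case L-inhab of λ (l , Ll) → c - l , subst L (sym (q-[q-p] c l)) Ll
  ; L-down   = λ p<q → U-up (sub-anti c p<q)
  ; U-up     = λ p<q → L-down (sub-anti c p<q)
  ; L-open   = λ {p} Up → case U-open Up of λ (s , s< , Us) →
      c - s , subst (_< c - s) (q-[q-p] c p) (sub-anti c s<)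
            , subst U (sym (q-[q-p] c s)) Us
  ; U-open   = λ {q} Lq → case L-open Lq of λ (s , <s , Ls) →
      c - s , subst (c - s <_) (q-[q-p] c q) (sub-anti c <s)
            , subst L (sym (q-[q-p] c s)) Ls
  ; disjoint = λ Uq Lq → disjoint Lq Uq
  ; located  = λ p<q → case located (sub-anti c p<q) of λ where
      (inj₁ Lq) → inj₂ Lq
      (inj₂ Up) → inj₁ Up
  } where open ℝ x

_-ℚ_ : ℝ → ℚ → ℝ
x -ℚ c = record
  { L        = λ q → L (q + c)
  ; U        = λ q → U (q + c)
  ; L-inhab  = case L-inhab of λ (l , Ll) → l - c , subst L (sym ([p-q]+q l c)) Ll
  ; U-inhab  = case U-inhab of λ (u , Uu) → u - c , subst U (sym ([p-q]+q u c)) Uu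
  ; L-down   = λ p<q → L-down (+-monoˡ-< c p<q)
  ; U-up     = λ p<q → U-up (+-monoˡ-< c p<q)
  ; L-open   = λ {p} Lp → case L-open Lp of λ (s , <s , Ls) →
      s - c , subst (_< s - c) (p+q-q p) (sub-mono c <s)
            , subst L (sym ([p-q]+q s c)) Ls
  ; U-open   = λ {q} Uq → case U-open Uq of λ (s , s< , Us) →
      s - c , subst (s - c <_) (p+q-q q) (sub-mono c s<)
            , subst U (sym ([p-q]+q s c)) Us
  ; disjoint = disjoint
  ; located  = λ p<q → located (+-monoˡ-< c p<q)
  } where
    open ℝ x
    p+q-q : ∀ p → (p + c) - c ≡ p
    p+q-q p = solve 2 (λ p q → (p :+ q) :- q := p) refl p c

_/2 : ℝ → ℝ
x /2 = record
  { L        = λ q → L (q + q)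
  ; U        = λ q → U (q + q)
  ; L-inhab  = case L-inhab of λ (l , Ll) → ½ * l , subst L (sym (½+½ l)) Ll
  ; U-inhab  = case U-inhab of λ (u , Uu) → ½ * u , subst U (sym (½+½ u)) Uu
  ; L-down   = λ p<q → L-down (dbl-mono p<q)
  ; U-up     = λ p<q → U-up (dbl-mono p<q)
  ; L-open   = λ {p} Lp → case L-open Lp of λ (s , <s , Ls) →
      ½ * s , subst (_< ½ * s) (½*dbl p) (half-mono <s)
            , subst L (sym (½+½ s)) Ls
  ; U-open   = λ {q} Uq → case U-open Uq of λ (s , s< , Us) →
      ½ * s , subst (½ * s <_) (½*dbl q) (half-mono s<)
            , subst U (sym (½+½ s)) Us
  ; disjoint = disjoint
  ; located  = λ p<q → located (dbl-mono p<q)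
  } where
    open ℝ x
    ½*dbl : ∀ p → ½ * (p + p) ≡ p
    ½*dbl p = trans (*-distribˡ-+ ½ p p) (½+½ p)

------------------------------------------------------------------------
-- Roots and rational powers

private
  *-mono-≤ : ∀ {a b c d} → 0ℚ ≤ a → 0ℚ ≤ d → a ≤ b → c ≤ d → a * c ≤ b * d
  *-mono-≤ {a} {b} {c} {d} 0≤a 0≤d a≤b c≤d = ≤-trans
    (*-monoˡ-≤-nonNeg a {{nonNegative 0≤a}} c≤d)
    (*-monoʳ-≤-nonNeg d {{nonNegative 0≤d}} a≤b)

  0≤^ : ∀ d {q} → 0ℚ ≤ q → 0ℚ ≤ q ^ d
  0≤^ zero        0≤q = nonNegative⁻¹ 1ℚ
  0≤^ (suc d) {q} 0≤q = *-mono-≤ {0ℚ} {q} {0ℚ} ≤-refl (0≤^ d 0≤q) 0≤q (0≤^ d 0≤q)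

  0<^ : ∀ d {q} → 0ℚ < q → 0ℚ < q ^ d
  0<^ zero        0<q = positive⁻¹ 1ℚ
  0<^ (suc d) {q} 0<q = positive⁻¹ (q * q ^ d)
    {{pos*pos⇒pos q {{positive 0<q}} (q ^ d) {{positive (0<^ d 0<q)}}}}

  ^-mono-≤ : ∀ d {p q} → 0ℚ ≤ p → p ≤ q → p ^ d ≤ q ^ d
  ^-mono-≤ zero    0≤p p≤q = ≤-refl
  ^-mono-≤ (suc d) 0≤p p≤q =
    *-mono-≤ 0≤p (0≤^ d (≤-trans 0≤p p≤q)) p≤q (^-mono-≤ d 0≤p p≤q)

  ^-mono-< : ∀ d {p q} → 0ℚ ≤ p → p < q → p ^ suc d < q ^ suc d
  ^-mono-< d {p} {q} 0≤p p<q = ≤-<-trans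
    (*-monoˡ-≤-nonNeg p {{nonNegative 0≤p}} (^-mono-≤ d 0≤p (<⇒≤ p<q)))
    (*-monoˡ-<-pos (q ^ d) {{positive (0<^ d (≤-<-trans 0≤p p<q))}} p<q)

  <+1 : ∀ q → q < q + 1ℚ
  <+1 q = subst (_< q + 1ℚ) (+-identityʳ q) (+-monoʳ-< q (positive⁻¹ 1ℚ))

  module _ (x : ℚ) (0<x : 0ℚ < x) where
    private instance
      _ = positive 0<x
      _ = pos⇒nonZero x
      _ = pos⇒nonNeg x

    quot : ℚ → ℚ
    quot m = 1/ x * m

    x*quot : ∀ m → x * quot m ≡ m
    x*quot m = trans (sym (*-assoc x (1/ x) m))
      (trans (cong (_* m) (*-inverseʳ x)) (*-identityˡ m))

    <-quot : ∀ {y m} → x * y < m → y < quot m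
    <-quot {y} {m} h = *-cancelˡ-<-nonNeg x (subst (x * y <_) (sym (x*quot m)) h)

    quot-< : ∀ {y m} → m < x * y → quot m < y
    quot-< {y} {m} h = *-cancelˡ-<-nonNeg x (subst (_< x * y) (sym (x*quot m)) h)

    *-open-above : ∀ {y c} → x * y < c → ∃[ z ] y < z × x * z < c
    *-open-above {y} {c} h = case <-dense h of λ (m , xy<m , m<c) →
      quot m , <-quot xy<m , subst (_< c) (sym (x*quot m)) m<c

    *-open-below : ∀ {y c} → 0ℚ < c → c < x * y → ∃[ z ] 0ℚ < z × z < y × c < x * z
    *-open-below {y} {c} 0<c h = case <-dense h of λ (m , c<m , m<xy) →
      quot m , <-quot (subst (_< m) (sym (*-zeroʳ x)) (<-trans 0<c c<m))
             , quot-< m<xy , subst (c <_) (sym (x*quot m)) c<m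

  *-open-above₀ : ∀ {x y c} → 0ℚ ≤ x → x * y < c → ∃[ z ] y < z × x * z < c
  *-open-above₀ {x} {y} {c} 0≤x h with <-cmp 0ℚ x
  ... | tri< 0<x _ _    = *-open-above x 0<x h
  ... | tri≈ _ refl _   = y + 1ℚ , <+1 y ,
    subst (_< c) (trans (*-zeroˡ y) (sym (*-zeroˡ (y + 1ℚ)))) h
  ... | tri> _ _ x<0    with () ← <-irrefl refl (<-≤-trans x<0 0≤x)

  ⊓-glb-< : ∀ {a p q} → a < p → a < q → a < p ⊓ q
  ⊓-glb-< {a} {p} {q} a<p a<q with ⊓-sel p q
  ... | inj₁ e = subst (a <_) (sym e) a<p
  ... | inj₂ e = subst (a <_) (sym e) a<q

  ⊔-lub-< : ∀ {a p q} → p < a → q < a → p ⊔ q < a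
  ⊔-lub-< {a} {p} {q} p<a q<a with ⊔-sel p q
  ... | inj₁ e = subst (_< a) (sym e) p<a
  ... | inj₂ e = subst (_< a) (sym e) q<a

  ^-open-above : ∀ d {q c} → 0ℚ ≤ q → q ^ d < c → ∃[ p ] q < p × p ^ d < c
  ^-open-above zero    {q}     0≤q h = q + 1ℚ , <+1 q , h
  ^-open-above (suc d) {q} {c} 0≤q h =
    case *-open-above₀ 0≤q h of λ (y , q^d<y , qy<c) →
    let 0≤y = ≤-trans (0≤^ d 0≤q) (<⇒≤ q^d<y) in
    case *-open-above₀ {y} {q} 0≤y (subst (_< c) (*-comm q y) qy<c) of λ (x , q<x , yx<c) →
    case ^-open-above d 0≤q q^d<y of λ (p , q<p , p^d<y) →
    let m   = x ⊓ p
        q<m = ⊓-glb-< q<x q<p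
        0≤m = ≤-trans 0≤q (<⇒≤ q<m)
    in m , q<m , ≤-<-trans
         (*-mono-≤ 0≤m 0≤y (p⊓q≤p x p)
           (≤-trans (^-mono-≤ d 0≤m (p⊓q≤q x p)) (<⇒≤ p^d<y)))
         (subst (_< c) (*-comm y x) yx<c)

  ^-open-below : ∀ d {q c} → 0ℚ < q → 0ℚ < c → c < q ^ d →
                 ∃[ p ] p < q × 0ℚ < p × c < p ^ d
  ^-open-below zero    {q}     0<q 0<c h =
    case <-dense 0<q of λ (p , 0<p , p<q) → p , p<q , 0<p , h
  ^-open-below (suc d) {q} {c} 0<q 0<c h =
    case *-open-below q 0<q 0<c h of λ (y , 0<y , y<q^d , c<qy) →
    case *-open-below y 0<y {q} 0<c (subst (c <_) (*-comm q y) c<qy) of λ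
      (x , 0<x , x<q , c<yx) →
    case ^-open-below d 0<q 0<y y<q^d of λ (p , p<q , 0<p , y<p^d) →
    let m   = x ⊔ p
        0<m = <-≤-trans 0<x (p≤p⊔q x p)
    in m , ⊔-lub-< x<q p<q , 0<m , <-≤-trans
         (subst (c <_) (*-comm y x) c<yx)
         (*-mono-≤ (<⇒≤ 0<x) (0≤^ d (<⇒≤ 0<m)) (p≤p⊔q x p)
           (≤-trans (<⇒≤ y<p^d) (^-mono-≤ d (<⇒≤ 0<p) (p≤q⊔p x p))))

-- The positive d-th root of c > 0.

root : (d : ℕ) .{{_ : ℕ.NonZero d}} (c : ℚ) → 0ℚ < c → ℝ
root d@(suc d-1) c 0<c = record
  { L        = λ q → q < 0ℚ ⊎ q ^ d < c
  ; U        = λ q → 0ℚ < q × c < q ^ d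
  ; L-inhab  = - 1ℚ , inj₁ (negative⁻¹ (- 1ℚ))
  ; U-inhab  = c + 1ℚ , 0<c+1 , c<[c+1]^d
  ; L-down   = L-down
  ; U-up     = λ p<q (0<p , h) →
      <-trans 0<p p<q , <-trans h (^-mono-< d-1 (<⇒≤ 0<p) p<q)
  ; L-open   = L-open
  ; U-open   = λ (0<q , h) → ^-open-below d 0<q 0<c h
  ; disjoint = λ where
      (inj₁ q<0) (0<q , _) → <-asym q<0 0<q
      (inj₂ h)   (_ , h′)  → <-asym h h′
  ; located  = located
  }
  where
  0<c+1 = <-trans 0<c (<+1 c)

  1≤[c+1]^ : ∀ n → 1ℚ ≤ (c + 1ℚ) ^ n
  1≤[c+1]^ zero    = ≤-refl
  1≤[c+1]^ (suc n) = *-mono-≤ {1ℚ} {c + 1ℚ} {1ℚ} (nonNegative⁻¹ 1ℚ)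
    (0≤^ n (<⇒≤ 0<c+1))
    (subst (_≤ c + 1ℚ) (+-identityˡ 1ℚ) (+-monoˡ-≤ 1ℚ (<⇒≤ 0<c)))
    (1≤[c+1]^ n)

  c<[c+1]^d : c < (c + 1ℚ) ^ d
  c<[c+1]^d = <-≤-trans (<+1 c) (subst (_≤ (c + 1ℚ) ^ d) (*-identityʳ (c + 1ℚ))
    (*-monoˡ-≤-nonNeg (c + 1ℚ) {{nonNegative (<⇒≤ 0<c+1)}} (1≤[c+1]^ d-1)))

  L-down : ∀ {p q} → p < q → q < 0ℚ ⊎ q ^ d < c → p < 0ℚ ⊎ p ^ d < c
  L-down         p<q (inj₁ q<0) = inj₁ (<-trans p<q q<0)
  L-down {p} {q} p<q (inj₂ h) with p <? 0ℚ
  ... | yes p<0 = inj₁ p<0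
  ... | no  p≮0 = inj₂ (<-trans (^-mono-< d-1 (≮⇒≥ p≮0) p<q) h)

  L-open : ∀ {p} → p < 0ℚ ⊎ p ^ d < c → ∃[ q ] p < q × (q < 0ℚ ⊎ q ^ d < c)
  L-open (inj₁ p<0) = case <-dense p<0 of λ (q , p<q , q<0) → q , p<q , inj₁ q<0
  L-open {p} (inj₂ h) with p <? 0ℚ
  ... | yes p<0 = L-open (inj₁ p<0)
  ... | no  p≮0 = case ^-open-above d (≮⇒≥ p≮0) h of λ
    (q , p<q , q^d<c) → q , p<q , inj₂ q^d<c

  located : ∀ {p q} → p < q → (p < 0ℚ ⊎ p ^ d < c) ⊎ (0ℚ < q × c < q ^ d)
  located {p} p<q with p <? 0ℚ | p ^ d <? c
  ... | yes p<0 | _     = inj₁ (inj₁ p<0)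
  ... | no _    | yes h = inj₁ (inj₂ h)
  ... | no p≮0  | no ¬h = inj₂
    ( ≤-<-trans (≮⇒≥ p≮0) p<q
    , ≤-<-trans (≮⇒≥ ¬h) (^-mono-< d-1 (≮⇒≥ p≮0) p<q))

infixr 8 _^ℤ_ _^ℚ_

_^ℤ_ : (b : ℕ) .{{_ : ℕ.NonZero b}} → ℤ → ℚ
b ^ℤ (+ n)    = + (b ℕ.^ n) / 1
b ^ℤ -[1+ n ] = (+ 1 / (b ℕ.^ suc n)) {{ℕ.m^n≢0 b (suc n)}}

^ℤ-pos : ∀ b .{{_ : ℕ.NonZero b}} z → 0ℚ < b ^ℤ z
^ℤ-pos b (+ n)    = positive⁻¹ _ {{normalize-pos (b ℕ.^ n) 1 {{_}} {{ℕ.m^n≢0 b n}}}}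
^ℤ-pos b -[1+ n ] = positive⁻¹ _ {{normalize-pos 1 (b ℕ.^ suc n) {{ℕ.m^n≢0 b (suc n)}}}}

-- b^(m/d) is the d-th root of b^m; it does not depend on whether the
-- fraction m/d is in lowest terms, so the exponent is left unnormalised.

_^ℚ_ : (b : ℕ) .{{_ : ℕ.NonZero b}} → ℚᵘ → ℝ
b ^ℚ p = root (ℚᵘ.↧ₙ p) (b ^ℤ ℚᵘ.↥ p) (^ℤ-pos b (ℚᵘ.↥ p))

{-# OPTIONS --safe #-}
-- The bound has no content for g = 4, where the error term is at least 1.  For
-- g ≥ 5 it follows, without the error term, from the deterministic estimate
-- 4 (r − 1) (|V| − 2 ν) ≤ |V|, because (r − 1)^r ≤ (4 (r − 1))^(r − 2).
--
-- Here ν is the matching number.  For the estimate, let S be a maximal set of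
-- nodes with ν(G − S) + |S| ≤ ν(G).
-- Then every node of G − S is missed by some maximum matching of G − S, so by
-- Gallai's lemma the nodes missed by one maximum matching M lie in different
-- components of G − S.  A component C sends either r edges to S, or fewer; in the
-- latter case C has a node without neighbours in S around which the absence of
-- triangles and 4-cycles forces at least 4 (r − 1) nodes into C.  As S receives at
-- most r |S| edges, M misses at most |S| + |V| / (4 (r − 1)) nodes of G − S.
--
-- The estimate is decidable, so the extremal choices are made under double
-- negation.
module Submission where

open import Defs

open import Algebra.Bundles using (CommutativeRing)
open import Data.Bool.Base using (Bool; false; T; _∨_)
open import Data.Bool.Properties using (T?)
open import Data.Empty using (⊥)
open import Data.Fin.Base as Fin using (Fin; zero; suc)
import Data.Fin.Permutation as Perm
import Data.Fin.Properties as Fin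
import Data.Integer.Base as ℤ
import Data.Integer.Properties as ℤ
open import Data.List.Base as List
  using (List; []; _∷_; _++_; allFin; cartesianProduct; filter; length; tabulate)
open import Data.List.Extrema.Nat using (xs≤max)
open import Data.List.Membership.Propositional using (_∈_)
open import Data.List.Membership.Propositional.Properties
  using (∈-++⁺ˡ; ∈-++⁺ʳ; ∈-map⁺; ∈-filter⁺; ∈-filter⁻)
open import Data.List.Properties using (length-++; filter-++)
open import Data.List.Relation.Unary.All as All using ([]; _∷_)
open import Data.List.Relation.Unary.AllPairs using ([]; _∷_)
open import Data.List.Relation.Unary.Any using (here; there)
open import Data.List.Relation.Unary.Linked using ([-]; _∷_)
open import Data.List.Relation.Unary.Unique.Propositional using (Unique)
import Data.List.Relation.Unary.Unique.Propositional.Properties as Unique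
open import Data.Nat.Base as ℕ
  using (ℕ; zero; suc; _+_; _*_; _∸_; _!; _≤_; _<_; z≤n; s≤s; z<s; NonZero; >-nonZero)
open import Data.Nat.DivMod using () renaming (_/_ to _div_)
open import Data.Nat.Properties
open import Data.Nat.Tactic.RingSolver using (solve-∀)
open import Data.Product.Base using (_×_; _,_; ∃-syntax; proj₁; proj₂)
open import Data.Rational.Base as ℚ using (ℚ; 0ℚ; 1ℚ; _/_; toℚᵘ)
import Data.Rational.Properties as ℚ
import Data.Rational.Solver as ℚ-Solver
import Data.Rational.Unnormalised.Base as ℚᵘ
open import Data.Rational.Unnormalised.Base using () renaming (-_ to -ᵘ_; _/_ to _/ᵘ_)
import Data.Rational.Unnormalised.Properties as ℚᵘ
open import Data.Sum.Base using (_⊎_; inj₁; inj₂)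
open import Function.Base using (_∘_; id)
open import Relation.Binary.Definitions using (tri<; tri≈; tri>)
open import Relation.Binary.PropositionalEquality
  using (_≡_; _≢_; refl; sym; trans; cong; cong₂; subst; module ≡-Reasoning)
open import Relation.Nullary using (Dec; yes; no; does; ¬_; contradiction)
open import Relation.Nullary.Decidable
  using (_×-dec_; _⊎-dec_; ¬?; decidable-stable; ¬¬-excluded-middle)
open import Relation.Unary using (Decidable)

open import Algebra.Properties.CommutativeSemiring.Exp
  (CommutativeRing.commutativeSemiring ℚ.+-*-commutativeRing) using (^-distrib-*)
open import Algebra.Properties.Semiring.Sum +-*-semiring
  using (sum; sum-syntax; sum-cong-≗; ∑-distrib-+; ∑-comm; ∑-permute; *-distribˡ-sum; *-distribʳ-sum)
open ℚ-Solver.+-*-Solver using (solve; _:+_; _:*_; _:-_; _:=_; con)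

-- Counting over Fin n

-- The Iverson bracket. All cardinalities below are sums of brackets, so that double counting
-- becomes `∑-comm`.
⟦_⟧ : {A : Set} → Dec A → ℕ
⟦ yes _ ⟧ = 1
⟦ no _ ⟧  = 0

module _ {A : Set} where

  ⟦⟧-yes : (a? : Dec A) → A → ⟦ a? ⟧ ≡ 1
  ⟦⟧-yes (yes _) a = refl
  ⟦⟧-yes (no ¬a) a = contradiction a ¬a

  ⟦⟧-no : (a? : Dec A) → ¬ A → ⟦ a? ⟧ ≡ 0
  ⟦⟧-no (yes a) ¬a = contradiction a ¬a
  ⟦⟧-no (no _)  ¬a = refl

  ⟦⟧≤1 : (a? : Dec A) → ⟦ a? ⟧ ≤ 1
  ⟦⟧≤1 (yes _) = ≤-refl
  ⟦⟧≤1 (no _)  = z≤n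

  ⟦⟧*-mono : (a? : Dec A) {m n : ℕ} → (A → m ≤ n) → ⟦ a? ⟧ * m ≤ ⟦ a? ⟧ * n
  ⟦⟧*-mono (yes a) f = *-monoʳ-≤ 1 (f a)
  ⟦⟧*-mono (no _)  f = z≤n

⟦⟧-mono : {A B : Set} (a? : Dec A) (b? : Dec B) → (A → B) → ⟦ a? ⟧ ≤ ⟦ b? ⟧
⟦⟧-mono (yes a) b? f = ≤-reflexive (sym (⟦⟧-yes b? (f a)))
⟦⟧-mono (no _)  b? f = z≤n

sum-mono-≤ : ∀ {n} {f g : Fin n → ℕ} → (∀ i → f i ≤ g i) → sum f ≤ sum g
sum-mono-≤ {zero}  f≤g = z≤n
sum-mono-≤ {suc n} f≤g = +-mono-≤ (f≤g zero) (sum-mono-≤ (f≤g ∘ suc))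

sum-const : ∀ n c → ∑[ i < n ] c ≡ n * c
sum-const zero    c = refl
sum-const (suc n) c = cong (c +_) (sum-const n c)

sum-zero : ∀ {n} {f : Fin n → ℕ} → (∀ i → f i ≡ 0) → sum f ≡ 0
sum-zero {n} f≡0 = trans (sum-cong-≗ f≡0) (trans (sum-const n 0) (*-zeroʳ n))

term≤sum : ∀ {n} (f : Fin n → ℕ) i → f i ≤ sum f
term≤sum f zero    = m≤m+n _ _
term≤sum f (suc i) = ≤-trans (term≤sum (f ∘ suc) i) (m≤n+m _ _)

count-unique≤1 : ∀ {n} {P : Fin n → Set} (P? : Decidable P) →
                 (∀ {i j} → P i → P j → i ≡ j) → ∑[ i < n ] ⟦ P? i ⟧ ≤ 1
count-unique≤1 {zero}  P? uniq = z≤n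
count-unique≤1 {suc n} P? uniq with P? zero
... | yes p = s≤s (≤-reflexive (sum-zero λ i →
  ⟦⟧-no (P? (suc i)) λ q → contradiction (uniq p q) Fin.0≢1+n))
... | no _  = count-unique≤1 (P? ∘ suc) (λ p q → Fin.suc-injective (uniq p q))

count-≡ : ∀ {n} (j : Fin n) → ∑[ i < n ] ⟦ i Fin.≟ j ⟧ ≡ 1
count-≡ j = ≤-antisym
  (count-unique≤1 (Fin._≟ j) (λ p q → trans p (sym q)))
  (≤-trans (≤-reflexive (sym (⟦⟧-yes (j Fin.≟ j) refl))) (term≤sum (λ i → ⟦ i Fin.≟ j ⟧) j))

-- Spreads a single value over all indices, so that a charge to one node can enter a pointwise
-- comparison.
count-[≡]* : ∀ {n} (j : Fin n) c → ∑[ i < n ] (⟦ i Fin.≟ j ⟧ * c) ≡ c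
count-[≡]* j c = trans (sym (*-distribʳ-sum c (λ i → ⟦ i Fin.≟ j ⟧)))
  (trans (cong (_* c) (count-≡ j)) (*-identityˡ c))

-- After exchanging the sums, each `v` lies in at most one of the sets `C u` with `U u`, so its
-- weight is counted at most once.
packing : ∀ {m n} {U : Fin m → Set} {C : Fin m → Fin n → Set}
          (U? : Decidable U) (C? : ∀ u → Decidable (C u)) →
          (∀ {u u′ v} → U u → C u v → U u′ → C u′ v → u ≡ u′) → (h : Fin n → ℕ) →
          ∑[ u < m ] (⟦ U? u ⟧ * ∑[ v < n ] (⟦ C? u v ⟧ * h v)) ≤ sum h
packing {m} {n} {U} {C} U? C? disjoint h = begin
  ∑[ u < m ] (⟦ U? u ⟧ * ∑[ v < n ] (⟦ C? u v ⟧ * h v))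
    ≡⟨ sum-cong-≗ (λ u → *-distribˡ-sum ⟦ U? u ⟧ (λ v → ⟦ C? u v ⟧ * h v)) ⟩
  ∑[ u < m ] ∑[ v < n ] (⟦ U? u ⟧ * (⟦ C? u v ⟧ * h v))
    ≡⟨ ∑-comm (λ u v → ⟦ U? u ⟧ * (⟦ C? u v ⟧ * h v)) ⟩
  ∑[ v < n ] ∑[ u < m ] (⟦ U? u ⟧ * (⟦ C? u v ⟧ * h v))
    ≤⟨ sum-mono-≤ column ⟩
  sum h ∎
  where
  open ≤-Reasoning

  both? : ∀ v u → Dec (U u × C u v)
  both? v u = U? u ×-dec C? u v

  merge : ∀ u v → ⟦ U? u ⟧ * (⟦ C? u v ⟧ * h v) ≡ ⟦ both? v u ⟧ * h v
  merge u v with U? u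
  ... | no _ = refl
  ... | yes _ with C? u v
  ...   | no _  = refl
  ...   | yes _ = +-identityʳ _

  column : ∀ v → ∑[ u < m ] (⟦ U? u ⟧ * (⟦ C? u v ⟧ * h v)) ≤ h v
  column v = begin
    ∑[ u < m ] (⟦ U? u ⟧ * (⟦ C? u v ⟧ * h v))
      ≡⟨ sum-cong-≗ (λ u → merge u v) ⟩
    ∑[ u < m ] (⟦ both? v u ⟧ * h v)
      ≡⟨ *-distribʳ-sum (h v) (λ u → ⟦ both? v u ⟧) ⟨
    (∑[ u < m ] ⟦ both? v u ⟧) * h v
      ≤⟨ *-monoˡ-≤ (h v) (count-unique≤1 (both? v) λ (Uu , Cuv) (Uu′ , Cu′v) → disjoint Uu Cuv Uu′ Cu′v) ⟩
    1 * h v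
      ≡⟨ *-identityˡ (h v) ⟩
    h v ∎

∑-distrib-+₃ : ∀ {n} (f g h : Fin n → ℕ) →
               ∑[ i < n ] (f i + g i + h i) ≡ sum f + sum g + sum h
∑-distrib-+₃ f g h = trans (∑-distrib-+ (λ i → f i + g i) h) (cong (_+ sum h) (∑-distrib-+ f g))

-- Lengths of filtered lists as sums

module _ {A : Set} {P : A → Set} (P? : Decidable P) where

  length-filter-∷ : ∀ x xs → length (filter P? (x ∷ xs)) ≡ ⟦ P? x ⟧ + length (filter P? xs)
  length-filter-∷ x xs with P? x
  ... | yes _ = refl
  ... | no _  = refl

  length-filter-tabulate : ∀ {n} (f : Fin n → A) →
                           length (filter P? (tabulate f)) ≡ ∑[ i < n ] ⟦ P? (f i) ⟧
  length-filter-tabulate {zero}  f = refl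
  length-filter-tabulate {suc n} f = trans (length-filter-∷ (f zero) (tabulate (f ∘ suc)))
    (cong (⟦ P? (f zero) ⟧ +_) (length-filter-tabulate (f ∘ suc)))

  length-filter-map : ∀ {B : Set} (f : B → A) xs →
                      length (filter P? (List.map f xs)) ≡ length (filter (P? ∘ f) xs)
  length-filter-map f []       = refl
  length-filter-map f (x ∷ xs) with P? (f x)
  ... | yes _ = cong suc (length-filter-map f xs)
  ... | no _  = length-filter-map f xs

length-filter-filter : ∀ {A : Set} {P Q : A → Set} (P? : Decidable P) (Q? : Decidable Q) xs →
                       length (filter Q? (filter P? xs)) ≡ length (filter (λ x → P? x ×-dec Q? x) xs)
length-filter-filter P? Q? []       = refl
length-filter-filter P? Q? (x ∷ xs) with P? x
... | no _  = length-filter-filter P? Q? xs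
... | yes _ with Q? x
...   | yes _ = cong suc (length-filter-filter P? Q? xs)
...   | no _  = length-filter-filter P? Q? xs

length-filter-cartesianProduct :
  ∀ {m n} {A B : Set} {P : A × B → Set} (P? : Decidable P) (f : Fin m → A) (g : Fin n → B) →
  length (filter P? (cartesianProduct (tabulate f) (tabulate g)))
    ≡ ∑[ i < m ] ∑[ j < n ] ⟦ P? (f i , g j) ⟧
length-filter-cartesianProduct {zero}  P? f g = refl
length-filter-cartesianProduct {suc m} P? f g = begin
  length (filter P? (row ++ rows))
    ≡⟨ cong length (filter-++ P? row rows) ⟩
  length (filter P? row ++ filter P? rows)
    ≡⟨ length-++ (filter P? row) ⟩
  length (filter P? row) + length (filter P? rows)
    ≡⟨ cong₂ _+_
         (trans (length-filter-map P? (f zero ,_) (tabulate g))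
                (length-filter-tabulate (P? ∘ (f zero ,_)) g))
         (length-filter-cartesianProduct P? (f ∘ suc) g) ⟩
  ∑[ i < suc m ] ∑[ j < _ ] ⟦ P? (f i , g j) ⟧ ∎
  where
  open ≡-Reasoning
  row  = List.map (f zero ,_) (tabulate g)
  rows = cartesianProduct (tabulate (f ∘ suc)) (tabulate g)

-- Finite choices under double negation

¬¬-∀Fin : ∀ {n} {P : Fin n → Set} → (∀ i → ¬ ¬ P i) → ¬ ¬ (∀ i → P i)
¬¬-∀Fin {zero}  ¬¬P k = k λ ()
¬¬-∀Fin {suc n} ¬¬P k = ¬¬P zero λ p → ¬¬-∀Fin (¬¬P ∘ suc) λ ps → k λ where
  zero    → p
  (suc i) → ps i

-- If no element were maximal, `μ` could be increased again and again past its bound. The fuel is an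
-- upper bound for the remaining distance to `b`.
¬¬-maximal : {A : Set} (P : A → Set) (μ : A → ℕ) (b : ℕ) → (∀ a → μ a ≤ b) →
             ∀ {a} → P a → ¬ ¬ (∃[ x ] P x × (∀ y → P y → μ y ≤ μ x))
¬¬-maximal P μ b μ≤b {a} Pa k = go b a Pa (m≤n+m b (μ a))
  where
  go : ∀ fuel a → P a → b ≤ μ a + fuel → ⊥
  go zero       a Pa b≤ = k (a , Pa , λ y _ → ≤-trans (μ≤b y) (subst (b ≤_) (+-identityʳ _) b≤))
  go (suc fuel) a Pa b≤ = k (a , Pa , λ y Py → ≮⇒≥ λ μa<μy →
    go fuel y Py (≤-trans b≤ (subst (_≤ μ y + fuel) (sym (+-suc (μ a) fuel)) (+-monoˡ-≤ fuel μa<μy))))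

-- Matchings as involutions

length≤1 : {A : Set} {xs : List A} → Unique xs → (∀ {x y} → x ∈ xs → y ∈ xs → x ≡ y) → length xs ≤ 1
length≤1 {xs = []}         _ _ = z≤n
length≤1 {xs = _ ∷ []}     _ _ = s≤s z≤n
length≤1 {xs = _ ∷ _ ∷ _} ((x≢y ∷ _) ∷ _) eq = contradiction (eq (here refl) (there (here refl))) x≢y

filter∈sublists : {A : Set} {P : A → Set} (P? : Decidable P) → ∀ xs → filter P? xs ∈ sublists xs
filter∈sublists P? []       = here refl
filter∈sublists P? (x ∷ xs) with P? x
... | yes _ = ∈-++⁺ʳ (sublists xs) (∈-map⁺ (x ∷_) (filter∈sublists P? xs))
... | no _  = ∈-++⁺ˡ (filter∈sublists P? xs)

module Simple (G : Graph) where
  open Graph G public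

  ~-sym : ∀ {u v} → u ~ v → v ~ u
  ~-sym {u} {v} = subst T (symm u v)

  ~⇒≢ : ∀ {u v} → u ~ v → u ≢ v
  ~⇒≢ {u} u~u refl = subst T (irrefl u) u~u

  _~?_ : ∀ u v → Dec (u ~ v)
  u ~? v = T? (adj u v)

  no-triangle : Girth≥ 5 → ∀ {u v w} → u ~ v → v ~ w → ¬ (w ~ u)
  no-triangle girth {u} {v} {w} u~v v~w w~u with
    girth u (v ∷ w ∷ []) (≤-refl
      , (~⇒≢ u~v ∷ ~⇒≢ w~u ∘ sym ∷ []) ∷ (~⇒≢ v~w ∷ []) ∷ [] ∷ []
      , u~v ∷ v~w ∷ w~u ∷ [-])
  ... | s≤s (s≤s (s≤s ()))

  no-4-cycle : Girth≥ 5 → ∀ {u v w x} → u ≢ w → v ≢ x → u ~ v → v ~ w → w ~ x → ¬ (x ~ u)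
  no-4-cycle girth {u} {v} {w} {x} u≢w v≢x u~v v~w w~x x~u with
    girth u (v ∷ w ∷ x ∷ []) (n≤1+n 3
      , (~⇒≢ u~v ∷ u≢w ∷ ~⇒≢ x~u ∘ sym ∷ []) ∷ (~⇒≢ v~w ∷ v≢x ∷ [])
          ∷ (~⇒≢ w~x ∷ []) ∷ [] ∷ []
      , u~v ∷ v~w ∷ w~x ∷ x~u ∷ [-])
  ... | s≤s (s≤s (s≤s (s≤s ())))

  -- A matching as the involution that swaps matched nodes and fixes the
  -- unmatched ones.
  record Mating : Set where
    field
      mate       : V → V
      involutive : ∀ v → mate (mate v) ≡ v
      mate-adj   : ∀ {v} → mate v ≢ v → v ~ mate v

    fixed? : ∀ v → Dec (mate v ≡ v)
    fixed? v = mate v Fin.≟ v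

    covered? : ∀ v → Dec (mate v ≢ v)
    covered? v = ¬? (fixed? v)

    cov : ℕ
    cov = ∑[ v < order ] ⟦ covered? v ⟧

    below? : ∀ v → Dec (v Fin.< mate v)
    below? v = v Fin.<? mate v

    size : ℕ
    size = ∑[ v < order ] ⟦ below? v ⟧

    -- A covered node lies either below or above its mate, and `mate`, as a permutation, exchanges
    -- the two kinds.
    cov-even : cov ≡ 2 * size
    cov-even = begin
      cov
        ≡⟨ sum-cong-≗ split ⟩
      ∑[ v < order ] (⟦ below? v ⟧ + ⟦ mate v Fin.<? v ⟧)
        ≡⟨ ∑-distrib-+ (λ v → ⟦ below? v ⟧) (λ v → ⟦ mate v Fin.<? v ⟧) ⟩
      size + ∑[ v < order ] ⟦ mate v Fin.<? v ⟧
        ≡⟨ cong (size +_) (trans (∑-permute _ π) (sum-cong-≗ unmate)) ⟩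
      size + size
        ≡⟨ double size ⟩
      2 * size ∎
      where
      open ≡-Reasoning

      π = Perm.permutation mate mate involutive involutive

      double : ∀ x → x + x ≡ 2 * x
      double = solve-∀

      unmate : ∀ v → ⟦ mate (mate v) Fin.<? mate v ⟧ ≡ ⟦ below? v ⟧
      unmate v = cong (λ w → ⟦ w Fin.<? mate v ⟧) (involutive v)

      split : ∀ v → ⟦ covered? v ⟧ ≡ ⟦ below? v ⟧ + ⟦ mate v Fin.<? v ⟧
      split v with Fin.<-cmp v (mate v)
      ... | tri< < ≢ ≯ = trans (⟦⟧-yes (covered? v) (≢ ∘ sym))
        (sym (cong₂ _+_ (⟦⟧-yes (below? v) <) (⟦⟧-no (mate v Fin.<? v) ≯)))
      ... | tri≈ ≮ ≡ ≯ = trans (⟦⟧-no (covered? v) λ ≢ → ≢ (sym ≡))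
        (sym (cong₂ _+_ (⟦⟧-no (below? v) ≮) (⟦⟧-no (mate v Fin.<? v) ≯)))
      ... | tri> ≮ ≢ > = trans (⟦⟧-yes (covered? v) (≢ ∘ sym))
        (sym (cong₂ _+_ (⟦⟧-no (below? v) ≮) (⟦⟧-yes (mate v Fin.<? v) >)))

    matched? : (e : V × V) → Dec (mate (proj₁ e) ≡ proj₂ e)
    matched? (u , w) = mate u Fin.≟ w

    mateEdges : List (V × V)
    mateEdges = filter matched? edges

    mateEdges-unique : Unique mateEdges
    mateEdges-unique = Unique.filter⁺ matched?
      (Unique.filter⁺ _ (Unique.cartesianProduct⁺ (Unique.allFin⁺ order) (Unique.allFin⁺ order)))

    mateEdges-isMatching : IsMatching mateEdges
    mateEdges-isMatching v = length≤1 (Unique.filter⁺ (incident? v) mateEdges-unique)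
      λ e∈ f∈ → incident-unique (mateEdges-good e∈) (mateEdges-good f∈)
      where
      Good : V × V → Set
      Good e = Incident v e × mate (proj₁ e) ≡ proj₂ e × proj₁ e Fin.< proj₂ e

      mateEdges-good : ∀ {e} → e ∈ filter (incident? v) mateEdges → Good e
      mateEdges-good e∈ with ∈-filter⁻ (incident? v) {xs = mateEdges} e∈
      ... | e∈′ , inc with ∈-filter⁻ matched? {xs = edges} e∈′
      ... | e∈″ , eq with ∈-filter⁻ _ {xs = cartesianProduct (allFin order) (allFin order)} e∈″
      ... | _ , < , _ = inc , eq , <

      incident-unique : ∀ {e f} → Good e → Good f → e ≡ f
      incident-unique (inj₁ refl , refl , _)  (inj₁ refl , refl , _)  = refl
      -- In the mixed cases the node is the smaller end of one edge and the larger end of the other,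
      -- but both edges lead to its mate.
      incident-unique (inj₁ refl , refl , u<) (inj₂ refl , eq , x<)   =
        contradiction (subst (Fin._< _) (trans (sym (involutive _)) (cong mate eq)) x<) (Fin.<-asym u<)
      incident-unique (inj₂ refl , eq , x<)   (inj₁ refl , refl , u<) =
        contradiction (subst (Fin._< _) (trans (sym (involutive _)) (cong mate eq)) x<) (Fin.<-asym u<)
      incident-unique {u , _} {x , _} (inj₂ refl , eq , _) (inj₂ refl , eq′ , _)  =
        cong (_, _) (trans (sym (involutive u)) (trans (cong mate (trans eq (sym eq′))) (involutive x)))

    size≤mateEdges : size ≤ length mateEdges
    size≤mateEdges = begin
      size
        ≤⟨ sum-mono-≤ (λ u → ≤-trans
             (⟦⟧-mono (below? u) (edge? (u , mate u)) (λ < → (< , mate-adj (Fin.<⇒≢ < ∘ sym)) , refl))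
             (term≤sum (λ w → ⟦ edge? (u , w) ⟧) (mate u))) ⟩
      ∑[ u < order ] ∑[ w < order ] ⟦ edge? (u , w) ⟧
        ≡⟨ length-filter-cartesianProduct edge? id id ⟨
      length (filter edge? (cartesianProduct (allFin order) (allFin order)))
        ≡⟨ length-filter-filter _ matched? (cartesianProduct (allFin order) (allFin order)) ⟨
      length mateEdges ∎
      where
      open ≤-Reasoning
      edge? : (e : V × V) → Dec _
      edge? e@(u , w) = ((u Fin.<? w) ×-dec T? (adj u w)) ×-dec matched? e

    -- The link to the matching number of the statement: `mateEdges` is among the lists over which
    -- the maximum is taken.
    size≤matchingNumber : size ≤ matchingNumber G
    size≤matchingNumber = ≤-trans size≤mateEdges
      (All.lookup (xs≤max 0 (List.map length (matchings G)))
        (∈-map⁺ length (∈-filter⁺ isMatching? (filter∈sublists matched? edges) mateEdges-isMatching)))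

-- Barriers and Gallai's lemma

module Barrier (G : Graph) where
  open Simple G
  open Mating

  -- The exchange behind Gallai's lemma: the edge at `y`, if any, gives way to the edge from the
  -- unmatched `x` to `y`, and its other end `z` becomes unmatched. If `y` is unmatched, then `z` is
  -- `y` and the exchange is a plain augmentation.
  module Rewire (N : Mating) {x y : V} (x~y : x ~ y) (x-fixed : mate N x ≡ x) where

    z : V
    z = mate N y

    x≢y : x ≢ y
    x≢y = ~⇒≢ x~y

    z≢x : z ≢ x
    z≢x z≡x = x≢y (trans (sym x-fixed) (trans (cong (mate N) (sym z≡x)) (involutive N y)))

    new : V → V
    new v with v Fin.≟ x | v Fin.≟ y | v Fin.≟ z
    ... | yes _ | _     | _     = y
    ... | no _  | yes _ | _     = x
    -- Reached only if `z` differs from `y`, since `y` is tested first; for unmatched `y` nothing is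
    -- removed.
    ... | no _  | no _  | yes _ = v
    ... | no _  | no _  | no _  = mate N v

    new-x : new x ≡ y
    new-x with x Fin.≟ x
    ... | yes _  = refl
    ... | no x≢x = contradiction refl x≢x

    new-y : new y ≡ x
    new-y with y Fin.≟ x | y Fin.≟ y
    ... | yes y≡x | _      = contradiction (sym y≡x) x≢y
    ... | no _    | yes _  = refl
    ... | no _    | no y≢y = contradiction refl y≢y

    new-z : z ≢ y → new z ≡ z
    new-z z≢y with z Fin.≟ x | z Fin.≟ y | z Fin.≟ z
    ... | yes z≡x | _       | _      = contradiction z≡x z≢x
    ... | no _    | yes z≡y | _      = contradiction z≡y z≢y
    ... | no _    | no _    | yes _  = refl
    ... | no _    | no _    | no z≢z = contradiction refl z≢z

    new-other : ∀ {v} → v ≢ x → v ≢ y → v ≢ z → new v ≡ mate N v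
    new-other {v} v≢x v≢y v≢z with v Fin.≟ x | v Fin.≟ y | v Fin.≟ z
    ... | yes v≡x | _       | _       = contradiction v≡x v≢x
    ... | no _    | yes v≡y | _       = contradiction v≡y v≢y
    ... | no _    | no _    | yes v≡z = contradiction v≡z v≢z
    ... | no _    | no _    | no _    = refl

    -- The cases of `new` with their evidence; matching on it keeps the tests inside `new` out of
    -- later goals.
    data Position (v : V) : Set where
      at-x  : v ≡ x → Position v
      at-y  : v ≡ y → Position v
      at-z  : v ≡ z → z ≢ y → Position v
      other : v ≢ x → v ≢ y → v ≢ z → Position v

    position : ∀ v → Position v
    position v with v Fin.≟ x | v Fin.≟ y | v Fin.≟ z
    ... | yes v≡x | _       | _       = at-x v≡x
    ... | no _    | yes v≡y | _       = at-y v≡y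
    ... | no _    | no v≢y  | yes v≡z = at-z v≡z (v≢y ∘ trans v≡z)
    ... | no v≢x  | no v≢y  | no v≢z  = other v≢x v≢y v≢z

    mate-≢ : ∀ {v w} → v ≢ mate N w → mate N v ≢ w
    mate-≢ v≢ eq = v≢ (trans (sym (involutive N _)) (cong (mate N) eq))

    rewired : Mating
    rewired .mate = new
    rewired .involutive v with position v
    ... | at-x refl       = trans (cong new new-x) new-y
    ... | at-y refl       = trans (cong new new-y) new-x
    ... | at-z refl z≢y   = trans (cong new (new-z z≢y)) (new-z z≢y)
    ... | other v≢x v≢y v≢z = begin
      new (new v)       ≡⟨ cong new (new-other v≢x v≢y v≢z) ⟩
      new (mate N v)
        ≡⟨ new-other (mate-≢ (v≢x ∘ λ eq → trans eq x-fixed)) (mate-≢ v≢z)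
             (mate-≢ (v≢y ∘ λ eq → trans eq (involutive N y))) ⟩
      mate N (mate N v) ≡⟨ involutive N v ⟩
      v                 ∎
      where open ≡-Reasoning
    rewired .mate-adj {v} new≢ with position v
    ... | at-x refl         = subst (x ~_) (sym new-x) x~y
    ... | at-y refl         = subst (y ~_) (sym new-y) (~-sym x~y)
    ... | at-z refl z≢y     = contradiction (new-z z≢y) new≢
    ... | other v≢x v≢y v≢z = subst (v ~_) (sym eq) (mate-adj N (new≢ ∘ trans eq))
      where eq = new-other v≢x v≢y v≢z

    rewired-fixes : ∀ {v} → v ≢ x → v ≢ y → mate N v ≡ v → new v ≡ v
    rewired-fixes {v} v≢x v≢y fixed with position v
    ... | at-x v≡x            = contradiction v≡x v≢x
    ... | at-y v≡y            = contradiction v≡y v≢y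
    ... | at-z refl z≢y       = new-z z≢y
    ... | other v≢x v≢y v≢z   = trans (new-other v≢x v≢y v≢z) fixed

    -- The nodes x and y become covered; if y was covered already, then z is
    -- lost in exchange.
    cov-rewired : cov N + 2 ≤ cov rewired + 2 * ⟦ covered? N y ⟧
    cov-rewired = begin
      cov N + 2
        ≡⟨ +-assoc (cov N) 1 1 ⟨
      cov N + 1 + 1
        ≡⟨ cong₂ (λ a b → cov N + a + b) (count-≡ x) (count-≡ y) ⟨
      cov N + ∑[ v < order ] ⟦ v Fin.≟ x ⟧ + ∑[ v < order ] ⟦ v Fin.≟ y ⟧
        ≡⟨ ∑-distrib-+₃ (λ v → ⟦ covered? N v ⟧) _ _ ⟨
      ∑[ v < order ] (⟦ covered? N v ⟧ + ⟦ v Fin.≟ x ⟧ + ⟦ v Fin.≟ y ⟧)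
        ≤⟨ sum-mono-≤ pointwise ⟩
      -- If `y` was covered, `c` is 1: the share at `y` pays for counting `y` twice on the left, the
      -- share at `z` for the lost mate.
      ∑[ v < order ] (⟦ covered? rewired v ⟧ + ⟦ v Fin.≟ y ⟧ * c + ⟦ v Fin.≟ z ⟧ * c)
        ≡⟨ ∑-distrib-+₃ (λ v → ⟦ covered? rewired v ⟧) _ _ ⟩
      cov rewired + ∑[ v < order ] (⟦ v Fin.≟ y ⟧ * c) + ∑[ v < order ] (⟦ v Fin.≟ z ⟧ * c)
        ≡⟨ cong₂ (λ a b → cov rewired + a + b) (count-[≡]* y c) (count-[≡]* z c) ⟩
      cov rewired + c + c
        ≡⟨ double (cov rewired) c ⟩
      cov rewired + 2 * c ∎
      where
      open ≤-Reasoning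
      c = ⟦ covered? N y ⟧

      double : ∀ a c → a + c + c ≡ a + 2 * c
      double = solve-∀

      pointwise : ∀ v → ⟦ covered? N v ⟧ + ⟦ v Fin.≟ x ⟧ + ⟦ v Fin.≟ y ⟧
                      ≤ ⟦ covered? rewired v ⟧ + ⟦ v Fin.≟ y ⟧ * c + ⟦ v Fin.≟ z ⟧ * c
      pointwise v with position v
      ... | at-x refl
        rewrite ⟦⟧-no (covered? N x) (λ ≢ → ≢ x-fixed)
              | ⟦⟧-yes (x Fin.≟ x) refl
              | ⟦⟧-no (x Fin.≟ y) x≢y
              | ⟦⟧-yes (covered? rewired x) (λ eq → x≢y (trans (sym eq) new-x))
        = s≤s z≤n
      ... | at-y refl
        rewrite ⟦⟧-no (y Fin.≟ x) (x≢y ∘ sym)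
              | ⟦⟧-yes (y Fin.≟ y) refl
              | ⟦⟧-yes (covered? rewired y) (λ eq → x≢y (trans (sym new-y) eq))
        = ≤-trans (≤-reflexive (solve₁ c)) (m≤m+n (1 + 1 * c) _)
        where
        solve₁ : ∀ c → c + 0 + 1 ≡ 1 + 1 * c
        solve₁ = solve-∀
      ... | at-z refl z≢y
        rewrite ⟦⟧-no (z Fin.≟ x) z≢x
              | ⟦⟧-no (z Fin.≟ y) z≢y
              | ⟦⟧-yes (z Fin.≟ z) refl
              | ⟦⟧-yes (covered? N y) z≢y
        = ≤-trans (≤-reflexive (trans (+-identityʳ _) (+-identityʳ _)))
            (≤-trans (⟦⟧≤1 (covered? N z)) (m≤n+m 1 _))
      ... | other v≢x v≢y v≢z
        rewrite ⟦⟧-no (v Fin.≟ x) v≢x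
              | ⟦⟧-no (v Fin.≟ y) v≢y
              | ⟦⟧-no (v Fin.≟ z) v≢z
        = +-monoˡ-≤ 0 (+-monoˡ-≤ 0 (⟦⟧-mono (covered? N v) (covered? rewired v)
            (_∘ trans (sym (new-other v≢x v≢y v≢z)))))

  agree : Mating → Mating → ℕ
  agree M N = ∑[ v < order ] ⟦ mate M v Fin.≟ mate N v ⟧

  -- Agreement is gained at `x`. None is lost at `y` or `z`: a mating that agrees with `M` at either
  -- would have `x` matched or `z` equal to `x`, while `N` leaves `x` unmatched.
  agree-rewired : ∀ M N {x y} (x~y : x ~ y) (x-fixed : mate N x ≡ x) → mate M x ≡ y →
                  agree M N < agree M (Rewire.rewired N x~y x-fixed)
  agree-rewired M N {x} {y} x~y x-fixed Mx≡y = begin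
    suc (agree M N)
      ≡⟨ +-comm 1 (agree M N) ⟩
    agree M N + 1
      ≡⟨ cong (agree M N +_) (count-≡ x) ⟨
    agree M N + ∑[ v < order ] ⟦ v Fin.≟ x ⟧
      ≡⟨ ∑-distrib-+ (λ v → ⟦ mate M v Fin.≟ mate N v ⟧) _ ⟨
    ∑[ v < order ] (⟦ mate M v Fin.≟ mate N v ⟧ + ⟦ v Fin.≟ x ⟧)
      ≤⟨ sum-mono-≤ pointwise ⟩
    agree M rewired ∎
    where
    open ≤-Reasoning
    open Rewire N x~y x-fixed

    My≡x : mate M y ≡ x
    My≡x = trans (cong (mate M) (sym Mx≡y)) (involutive M x)

    pointwise : ∀ v → ⟦ mate M v Fin.≟ mate N v ⟧ + ⟦ v Fin.≟ x ⟧ ≤ ⟦ mate M v Fin.≟ new v ⟧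
    pointwise v with position v
    ... | at-x refl
      rewrite ⟦⟧-no (mate M x Fin.≟ mate N x) (λ eq → x≢y (trans (sym x-fixed) (trans (sym eq) Mx≡y)))
            | ⟦⟧-yes (x Fin.≟ x) refl
            | ⟦⟧-yes (mate M x Fin.≟ new x) (trans Mx≡y (sym new-x))
      = ≤-refl
    ... | at-y refl
      rewrite ⟦⟧-no (mate M y Fin.≟ mate N y) (λ eq → z≢x (trans (sym eq) My≡x))
            | ⟦⟧-no (y Fin.≟ x) (x≢y ∘ sym)
      = z≤n
    ... | at-z refl z≢y
      rewrite ⟦⟧-no (mate M z Fin.≟ mate N z) (λ eq → z≢x (trans (sym (involutive M z))
                (trans (cong (mate M) (trans eq (involutive N y))) My≡x)))
            | ⟦⟧-no (z Fin.≟ x) z≢x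
      = z≤n
    ... | other v≢x v≢y v≢z
      rewrite ⟦⟧-no (v Fin.≟ x) v≢x
            | new-other v≢x v≢y v≢z
      = ≤-reflexive (+-identityʳ _)

  ∣_∣ₛ : (V → Bool) → ℕ
  ∣ S ∣ₛ = ∑[ v < order ] ⟦ T? (S v) ⟧

  Avoids : (V → Bool) → Mating → Set
  Avoids S M = ∀ v → T (S v) → mate M v ≡ v

  -- A mating that avoids `S` is a matching of G - S, and `cov` is twice its number of edges. So for
  -- `ν` the matching number this reads ν(G - S) + |S| ≤ ν(G).
  IsBarrier : ℕ → (V → Bool) → Set
  IsBarrier ν S = ∀ M → Avoids S M → cov M + 2 * ∣ S ∣ₛ ≤ 2 * ν

module Tightness (G : Graph) (ν : ℕ) (S : Graph.V G → Bool) (barrier : Barrier.IsBarrier G ν S) where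
  open Simple G
  open Mating
  open Barrier G

  -- The barrier inequality reversed: tight matings attain equality there, and are maximum matchings
  -- of G - S.
  Tight : Mating → Set
  Tight M = Avoids S M × 2 * ν ≤ cov M + 2 * ∣ S ∣ₛ

  Together : V → V → Set
  Together u v = ∃[ M ] Tight M × mate M u ≡ u × mate M v ≡ v

  together-sym : ∀ {u v} → Together u v → Together v u
  together-sym (M , tight , u-fixed , v-fixed) = M , tight , v-fixed , u-fixed

  avoids-rewired : ∀ N {x y} (x~y : x ~ y) (x-fixed : mate N x ≡ x) → Avoids S N →
                   ¬ T (S x) → ¬ T (S y) → Avoids S (Rewire.rewired N x~y x-fixed)
  avoids-rewired N x~y x-fixed avoids x∉S y∉S v v∈S = Rewire.rewired-fixes N x~y x-fixed
    (λ { refl → x∉S v∈S }) (λ { refl → y∉S v∈S }) (avoids v v∈S)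

  -- Otherwise the edge could be added to a tight matching, which would then violate the barrier
  -- inequality.
  adjacent⇒¬together : ∀ {u v} → u ~ v → ¬ T (S u) → ¬ T (S v) → ¬ Together u v
  adjacent⇒¬together {u} {v} u~v u∉S v∉S (M , (avoids , tight) , u-fixed , v-fixed) =
    <-irrefl refl (begin-strict
      2 * ν                  ≤⟨ tight ⟩
      cov M + 2 * ∣ S ∣ₛ     <⟨ +-monoˡ-< (2 * ∣ S ∣ₛ) (m<m+n (cov M) z<s) ⟩
      cov M + 2 + 2 * ∣ S ∣ₛ ≤⟨ +-monoˡ-≤ (2 * ∣ S ∣ₛ) cov-rewired ⟩
      cov rewired + 2 * ⟦ covered? M v ⟧ + 2 * ∣ S ∣ₛ
        ≡⟨ cong (λ c → cov rewired + 2 * c + 2 * ∣ S ∣ₛ) (⟦⟧-no (covered? M v) (λ ≢ → ≢ v-fixed)) ⟩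
      cov rewired + 0 + 2 * ∣ S ∣ₛ ≡⟨ cong (_+ 2 * ∣ S ∣ₛ) (+-identityʳ (cov rewired)) ⟩
      cov rewired + 2 * ∣ S ∣ₛ     ≤⟨ barrier rewired (avoids-rewired M u~v u-fixed avoids u∉S v∉S) ⟩
      2 * ν                        ∎)
    where
    open ≤-Reasoning
    open Rewire M u~v u-fixed

  -- Gallai's exchange argument: among the tight matchings missing t take N
  -- agreeing with M as much as possible.  As N covers u and v, and M does
  -- not, M covers some x ≠ t missed by N; swapping the edge of M at x into N
  -- yields a larger matching or one that agrees more with M.
  gallai : ∀ {u v} t → u ≢ v → Together u v → ¬ Together t u → ¬ Together t v →
           ¬ (∃[ N ] Tight N × mate N t ≡ t)
  gallai {u} {v} t u≢v (M , (M-avoids , M-tight) , Mu , Mv) ¬tu ¬tv (N₀ , N₀-ok) =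
    ¬¬-maximal (λ N → Tight N × mate N t ≡ t) (agree M) order agree≤ {N₀} N₀-ok maximal⇒⊥
    where
    open ≤-Reasoning

    agree≤ : ∀ N → agree M N ≤ order
    agree≤ N = ≤-trans (sum-mono-≤ (λ v → ⟦⟧≤1 (mate M v Fin.≟ mate N v)))
      (≤-reflexive (trans (sum-const order 1) (*-identityʳ order)))

    maximal⇒⊥ : ¬ (∃[ N ] (Tight N × mate N t ≡ t)
                  × (∀ N′ → Tight N′ × mate N′ t ≡ t → agree M N′ ≤ agree M N))
    maximal⇒⊥ (N , ((N-avoids , N-tight) , Nt) , maximal)
      with Fin.any? (λ x → ¬? (x Fin.≟ t) ×-dec covered? M x ×-dec fixed? N x)
    -- Apart from `t`, all that `M` covers is covered by `N`, which also covers `u` and `v`. So `N`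
    -- covers at least one node more than `M`, although `M` is tight.
    ... | no ¬∃x = <-irrefl refl (begin-strict
      cov M + 1
        <⟨ +-monoʳ-< (cov M) (n<1+n 1) ⟩
      cov M + 2
        ≡⟨ +-assoc (cov M) 1 1 ⟨
      cov M + 1 + 1
        ≡⟨ cong₂ (λ a b → cov M + a + b) (count-≡ u) (count-≡ v) ⟨
      cov M + ∑[ w < order ] ⟦ w Fin.≟ u ⟧ + ∑[ w < order ] ⟦ w Fin.≟ v ⟧
        ≡⟨ ∑-distrib-+₃ (λ w → ⟦ covered? M w ⟧) _ _ ⟨
      ∑[ w < order ] (⟦ covered? M w ⟧ + ⟦ w Fin.≟ u ⟧ + ⟦ w Fin.≟ v ⟧)
        ≤⟨ sum-mono-≤ pointwise ⟩
      ∑[ w < order ] (⟦ covered? N w ⟧ + ⟦ w Fin.≟ t ⟧)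
        ≡⟨ ∑-distrib-+ (λ w → ⟦ covered? N w ⟧) _ ⟩
      cov N + ∑[ w < order ] ⟦ w Fin.≟ t ⟧
        ≡⟨ cong (cov N +_) (count-≡ t) ⟩
      cov N + 1
        ≤⟨ +-monoˡ-≤ 1 (+-cancelʳ-≤ (2 * ∣ S ∣ₛ) (cov N) (cov M) (≤-trans (barrier N N-avoids) M-tight)) ⟩
      cov M + 1 ∎)
      where
      pointwise : ∀ w → ⟦ covered? M w ⟧ + ⟦ w Fin.≟ u ⟧ + ⟦ w Fin.≟ v ⟧
                      ≤ ⟦ covered? N w ⟧ + ⟦ w Fin.≟ t ⟧
      pointwise w with w Fin.≟ u | w Fin.≟ v
      ... | yes refl | yes refl = contradiction refl u≢v
      ... | yes refl | no _
        rewrite ⟦⟧-no (covered? M u) (λ ≢ → ≢ Mu)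
              | ⟦⟧-yes (covered? N u) (λ Nu → ¬tu (N , (N-avoids , N-tight) , Nt , Nu))
        = s≤s z≤n
      ... | no _ | yes refl
        rewrite ⟦⟧-no (covered? M v) (λ ≢ → ≢ Mv)
              | ⟦⟧-yes (covered? N v) (λ Nv → ¬tv (N , (N-avoids , N-tight) , Nt , Nv))
        = s≤s z≤n
      ... | no _ | no _ with w Fin.≟ t
      ...   | yes refl = ≤-trans (≤-reflexive (trans (+-identityʳ _) (+-identityʳ _)))
        (≤-trans (⟦⟧≤1 (covered? M w)) (m≤n+m 1 _))
      ...   | no w≢t = +-monoˡ-≤ 0 (≤-trans (≤-reflexive (+-identityʳ _))
        (⟦⟧-mono (covered? M w) (covered? N w) (λ Mw≢w Nw → ¬∃x (w , w≢t , Mw≢w , Nw))))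
    -- Were `y` missed by `N`, the adjacent nodes `x` and `y` would be missed together. So the
    -- exchange trades one edge for another: the result is tight, still misses `t`, and agrees more
    -- with `M`.
    ... | yes (x , x≢t , Mx≢x , Nx) = <⇒≱
      (agree-rewired M N x~y Nx refl)
      (maximal rewired ((rewired-avoids , rewired-tight) , rewired-fixes (x≢t ∘ sym) t≢y Nt))
      where
      y = mate M x
      x~y = mate-adj M Mx≢x

      open Rewire N x~y Nx

      x∉S : ¬ T (S x)
      x∉S x∈S = Mx≢x (M-avoids x x∈S)

      y∉S : ¬ T (S y)
      y∉S y∈S = Mx≢x (trans (sym (M-avoids y y∈S)) (involutive M x))

      rewired-avoids = avoids-rewired N x~y Nx N-avoids x∉S y∉S

      y-covered : mate N y ≢ y
      y-covered Ny = adjacent⇒¬together x~y x∉S y∉S (N , (N-avoids , N-tight) , Nx , Ny)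

      t≢y : t ≢ y
      t≢y refl = y-covered Nt

      rewired-tight : 2 * ν ≤ cov rewired + 2 * ∣ S ∣ₛ
      rewired-tight = ≤-trans N-tight (+-monoˡ-≤ (2 * ∣ S ∣ₛ)
        (+-cancelʳ-≤ 2 (cov N) (cov rewired) (subst (λ c → cov N + 2 ≤ cov rewired + 2 * c)
          (⟦⟧-yes (covered? N y) y-covered) cov-rewired)))

-- Isoperimetry in girth five

module Isoperimetry (G : Graph) (girth : Graph.Girth≥ G 5)
                    {r : ℕ} (regular : Graph.Regular G r)
                    (S : Graph.V G → Bool) where
  open Simple G

  ∑-adj : ∀ v → ∑[ w < order ] ⟦ v ~? w ⟧ ≡ r
  ∑-adj v = trans (sym (length-filter-tabulate (v ~?_) id)) (regular v)

  paths : V → V → ℕ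
  paths v z = ∑[ w < order ] (⟦ v ~? w ⟧ * ⟦ w ~? z ⟧)

  ∑-paths : ∀ v → ∑[ z < order ] paths v z ≡ r * r
  ∑-paths v = begin
    ∑[ z < order ] ∑[ w < order ] (⟦ v ~? w ⟧ * ⟦ w ~? z ⟧)
      ≡⟨ ∑-comm (λ z w → ⟦ v ~? w ⟧ * ⟦ w ~? z ⟧) ⟩
    ∑[ w < order ] ∑[ z < order ] (⟦ v ~? w ⟧ * ⟦ w ~? z ⟧)
      ≡⟨ sum-cong-≗ (λ w → trans (sym (*-distribˡ-sum ⟦ v ~? w ⟧ (λ z → ⟦ w ~? z ⟧))) (cong (⟦ v ~? w ⟧ *_) (∑-adj w))) ⟩
    ∑[ w < order ] (⟦ v ~? w ⟧ * r)
      ≡⟨ *-distribʳ-sum r (λ w → ⟦ v ~? w ⟧) ⟨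
    (∑[ w < order ] ⟦ v ~? w ⟧) * r
      ≡⟨ cong (_* r) (∑-adj v) ⟩
    r * r ∎
    where open ≡-Reasoning

  paths≡0 : ∀ {v z} → (∀ {w} → v ~ w → ¬ (w ~ z)) → paths v z ≡ 0
  paths≡0 {v} {z} none = sum-zero λ w → zero-term w
    where
    zero-term : ∀ w → ⟦ v ~? w ⟧ * ⟦ w ~? z ⟧ ≡ 0
    zero-term w with v ~? w
    ... | no _    = refl
    ... | yes v~w = trans (*-identityˡ _) (⟦⟧-no (w ~? z) (none v~w))

  paths≤r : ∀ v z → paths v z ≤ r
  paths≤r v z = ≤-trans
    (sum-mono-≤ λ w → ≤-trans (*-monoʳ-≤ ⟦ v ~? w ⟧ (⟦⟧≤1 (w ~? z))) (≤-reflexive (*-identityʳ _)))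
    (≤-reflexive (∑-adj v))

  paths≤1 : ∀ {v z} → v ≢ z → paths v z ≤ 1
  paths≤1 {v} {z} v≢z = ≤-trans (sum-mono-≤ both)
    (count-unique≤1 (λ w → (v ~? w) ×-dec (w ~? z)) unique)
    where
    both : ∀ w → ⟦ v ~? w ⟧ * ⟦ w ~? z ⟧ ≤ ⟦ (v ~? w) ×-dec (w ~? z) ⟧
    both w with v ~? w
    ... | no _    = z≤n
    ... | yes v~w = ≤-trans (≤-reflexive (*-identityˡ _))
      (⟦⟧-mono (w ~? z) (yes v~w ×-dec (w ~? z)) (v~w ,_))

    unique : ∀ {w x} → v ~ w × w ~ z → v ~ x × x ~ z → w ≡ x
    unique {w} {x} (v~w , w~z) (v~x , x~z) with w Fin.≟ x
    ... | yes w≡x = w≡x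
    ... | no w≢x  = contradiction (~-sym v~x) (no-4-cycle girth v≢z w≢x v~w w~z (~-sym x~z))

  -- Without triangles and 4-cycles, a node other than `v` is counted at most once on the left. The
  -- extra `r` at `v` absorbs the walks that return to `v`.
  ball : ∀ v z → ⟦ z Fin.≟ v ⟧ + ⟦ v ~? z ⟧ + paths v z ≤ 1 + ⟦ z Fin.≟ v ⟧ * r
  ball v z with z Fin.≟ v
  ... | yes refl rewrite ⟦⟧-no (v ~? v) (λ v~v → ~⇒≢ v~v refl) =
    +-monoʳ-≤ 1 (≤-trans (paths≤r v v) (≤-reflexive (sym (*-identityˡ r))))
  ... | no z≢v with v ~? z
  ...   | yes v~z = ≤-reflexive (cong suc
    (paths≡0 λ v~w w~z → no-triangle girth v~w w~z (~-sym v~z)))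
  ...   | no _    = paths≤1 (z≢v ∘ sym)

  S-degree : V → ℕ
  S-degree v = ∑[ w < order ] (⟦ T? (S w) ⟧ * ⟦ v ~? w ⟧)

  S-degree≡0 : ∀ {v w} → S-degree v ≡ 0 → v ~ w → ¬ T (S w)
  S-degree≡0 {v} {w} s≡0 v~w w∈S = 1+n≰n (begin
    1
      ≡⟨ cong₂ _*_ (⟦⟧-yes (T? (S w)) w∈S) (⟦⟧-yes (v ~? w) v~w) ⟨
    ⟦ T? (S w) ⟧ * ⟦ v ~? w ⟧
      ≤⟨ term≤sum (λ w → ⟦ T? (S w) ⟧ * ⟦ v ~? w ⟧) w ⟩
    S-degree v
      ≡⟨ s≡0 ⟩
    0 ∎)
    where open ≤-Reasoning

  module _ {C : V → Set} (C? : Decidable C)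
           (closed : ∀ {v w} → C v → v ~ w → ¬ T (S w) → C w) where

    ∣C∣ ∂C : ℕ
    ∣C∣ = ∑[ v < order ] ⟦ C? v ⟧
    ∂C  = ∑[ v < order ] (⟦ C? v ⟧ * S-degree v)

    -- Each of the `r` neighbours of `u` yields an edge to `S`: one in `S` through its edge to `u`,
    -- any other because it lies in `C` and has itself a neighbour in `S`.
    boundary-large : ∀ {u} → C u → (∀ v → C v → S-degree v ≢ 0) → r ≤ ∂C
    boundary-large {u} Cu s≢0 = begin
      r
        ≡⟨ ∑-adj u ⟨
      ∑[ w < order ] ⟦ u ~? w ⟧
        ≤⟨ sum-mono-≤ split ⟩
      ∑[ w < order ] (⟦ C? w ⟧ * ⟦ u ~? w ⟧ + ⟦ T? (S w) ⟧ * ⟦ u ~? w ⟧)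
        ≡⟨ ∑-distrib-+ (λ w → ⟦ C? w ⟧ * ⟦ u ~? w ⟧) _ ⟩
      ∑[ w < order ] (⟦ C? w ⟧ * ⟦ u ~? w ⟧) + S-degree u
        ≡⟨ cong (∑[ w < order ] (⟦ C? w ⟧ * ⟦ u ~? w ⟧) +_) (count-[≡]* u (S-degree u)) ⟨
      ∑[ w < order ] (⟦ C? w ⟧ * ⟦ u ~? w ⟧) + ∑[ w < order ] (⟦ w Fin.≟ u ⟧ * S-degree u)
        ≡⟨ ∑-distrib-+ (λ w → ⟦ C? w ⟧ * ⟦ u ~? w ⟧) _ ⟨
      ∑[ w < order ] (⟦ C? w ⟧ * ⟦ u ~? w ⟧ + ⟦ w Fin.≟ u ⟧ * S-degree u)
        ≤⟨ sum-mono-≤ charge ⟩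
      ∂C ∎
      where
      open ≤-Reasoning

      split : ∀ w → ⟦ u ~? w ⟧ ≤ ⟦ C? w ⟧ * ⟦ u ~? w ⟧ + ⟦ T? (S w) ⟧ * ⟦ u ~? w ⟧
      split w with u ~? w
      ... | no _ = z≤n
      ... | yes u~w with T? (S w)
      ...   | yes _  = m≤n+m 1 _
      ...   | no w∉S rewrite ⟦⟧-yes (C? w) (closed Cu u~w w∉S) = ≤-refl

      charge : ∀ w → ⟦ C? w ⟧ * ⟦ u ~? w ⟧ + ⟦ w Fin.≟ u ⟧ * S-degree u ≤ ⟦ C? w ⟧ * S-degree w
      charge w with w Fin.≟ u
      ... | yes refl
        rewrite ⟦⟧-yes (C? u) Cu
              | ⟦⟧-no (u ~? u) (λ u~u → ~⇒≢ u~u refl) = ≤-refl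
      ... | no _ = ≤-trans (≤-reflexive (+-identityʳ _))
        (⟦⟧*-mono (C? w) λ Cw → ≤-trans (⟦⟧≤1 (u ~? w)) (n≢0⇒n>0 (s≢0 w Cw)))

    -- A node with no neighbour in S sees 1 + r + r (r − 1) nodes within
    -- distance two, and those outside C lie in S.
    volume-large : ∀ {v} → C v → S-degree v ≡ 0 → 1 + r * r ≤ ∣C∣ + ∂C
    -- The `r` added on both sides stands for the walks from `v` to a neighbour and back.
    volume-large {v} Cv s≡0 = +-cancelʳ-≤ r _ _ (begin
      1 + r * r + r
        ≡⟨ swap r ⟩
      1 + r + r * r
        ≡⟨ cong₂ _+_ (cong₂ _+_ (count-≡ v) (∑-adj v)) (∑-paths v) ⟨
      ∑[ z < order ] ⟦ z Fin.≟ v ⟧ + ∑[ z < order ] ⟦ v ~? z ⟧ + ∑[ z < order ] paths v z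
        ≡⟨ ∑-distrib-+₃ (λ z → ⟦ z Fin.≟ v ⟧) _ _ ⟨
      ∑[ z < order ] (⟦ z Fin.≟ v ⟧ + ⟦ v ~? z ⟧ + paths v z)
        ≤⟨ sum-mono-≤ pointwise ⟩
      ∑[ z < order ] (⟦ C? z ⟧ + ⟦ z Fin.≟ v ⟧ * r + ⟦ T? (S z) ⟧ * paths v z)
        ≡⟨ ∑-distrib-+₃ (λ z → ⟦ C? z ⟧) _ _ ⟩
      ∣C∣ + ∑[ z < order ] (⟦ z Fin.≟ v ⟧ * r) + ∑[ z < order ] (⟦ T? (S z) ⟧ * paths v z)
        ≡⟨ cong (λ k → ∣C∣ + k + ∑[ z < order ] (⟦ T? (S z) ⟧ * paths v z)) (count-[≡]* v r) ⟩
      ∣C∣ + r + ∑[ z < order ] (⟦ T? (S z) ⟧ * paths v z)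
        ≤⟨ +-monoʳ-≤ (∣C∣ + r) escapes ⟩
      ∣C∣ + r + ∂C
        ≡⟨ rearrange ∣C∣ r ∂C ⟩
      ∣C∣ + ∂C + r ∎)
      where
      open ≤-Reasoning

      swap : ∀ r → 1 + r * r + r ≡ 1 + r + r * r
      swap = solve-∀

      rearrange : ∀ a b c → a + b + c ≡ a + c + b
      rearrange = solve-∀

      C-nbr : ∀ {w} → v ~ w → C w
      C-nbr v~w = closed Cv v~w (S-degree≡0 s≡0 v~w)

      pointwise : ∀ z → ⟦ z Fin.≟ v ⟧ + ⟦ v ~? z ⟧ + paths v z
                      ≤ ⟦ C? z ⟧ + ⟦ z Fin.≟ v ⟧ * r + ⟦ T? (S z) ⟧ * paths v z
      pointwise z with C? z
      ... | yes _  = ≤-trans (ball v z) (m≤m+n _ _)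
      ... | no z∉C
        rewrite ⟦⟧-no (z Fin.≟ v) (λ { refl → z∉C Cv })
              | ⟦⟧-no (v ~? z) (z∉C ∘ C-nbr)
        with T? (S z)
      ...   | yes _  = ≤-reflexive (sym (*-identityˡ _))
      ...   | no z∉S = ≤-reflexive (paths≡0 λ v~w w~z → z∉C (closed (C-nbr v~w) w~z z∉S))

      -- A walk from `v` to `S` ends with an edge from a neighbour of `v`, which lies in `C`, to
      -- `S`.
      escapes : ∑[ z < order ] (⟦ T? (S z) ⟧ * paths v z) ≤ ∂C
      escapes = begin
        ∑[ z < order ] (⟦ T? (S z) ⟧ * paths v z)
          ≡⟨ sum-cong-≗ (λ z → trans (*-distribˡ-sum ⟦ T? (S z) ⟧ (λ w → ⟦ v ~? w ⟧ * ⟦ w ~? z ⟧))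
               (sum-cong-≗ λ w → swap₃ ⟦ T? (S z) ⟧ ⟦ v ~? w ⟧ ⟦ w ~? z ⟧)) ⟩
        ∑[ z < order ] ∑[ w < order ] (⟦ v ~? w ⟧ * (⟦ T? (S z) ⟧ * ⟦ w ~? z ⟧))
          ≡⟨ ∑-comm (λ z w → ⟦ v ~? w ⟧ * (⟦ T? (S z) ⟧ * ⟦ w ~? z ⟧)) ⟩
        ∑[ w < order ] ∑[ z < order ] (⟦ v ~? w ⟧ * (⟦ T? (S z) ⟧ * ⟦ w ~? z ⟧))
          ≡⟨ sum-cong-≗ (λ w → sym (*-distribˡ-sum ⟦ v ~? w ⟧ (λ z → ⟦ T? (S z) ⟧ * ⟦ w ~? z ⟧))) ⟩
        ∑[ w < order ] (⟦ v ~? w ⟧ * S-degree w)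
          ≤⟨ sum-mono-≤ (λ w → *-monoˡ-≤ (S-degree w) (⟦⟧-mono (v ~? w) (C? w) C-nbr)) ⟩
        ∂C ∎
        where
        swap₃ : ∀ a b c → a * (b * c) ≡ b * (a * c)
        swap₃ = solve-∀

  -- With k = 4 (r - 1), each edge to `S` weighs k and each node r. A boundary of r edges is heavy
  -- enough; otherwise `volume-large` applies, and because r ≤ k a boundary edge weighs at least as
  -- much as a node.
  isoperimetry : ∀ {j} → r ≡ 2 + j → {C : V → Set} (C? : Decidable C) →
                 (∀ {v w} → C v → v ~ w → ¬ T (S w) → C w) → ∀ {u} → C u →
                 4 * (1 + j) * r ≤ ∑[ v < order ] (⟦ C? v ⟧ * (4 * (1 + j) * S-degree v + r))
  isoperimetry {j} refl {C} C? closed {u} Cu = begin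
    4 * (1 + j) * r
      ≤⟨ bound ⟩
    4 * (1 + j) * ∂C C? closed + ∣C∣ C? closed * r
      ≡⟨ cong₂ _+_ (*-distribˡ-sum (4 * (1 + j)) (λ v → ⟦ C? v ⟧ * S-degree v))
           (*-distribʳ-sum r (λ v → ⟦ C? v ⟧)) ⟩
    ∑[ v < order ] (4 * (1 + j) * (⟦ C? v ⟧ * S-degree v)) + ∑[ v < order ] (⟦ C? v ⟧ * r)
      ≡⟨ ∑-distrib-+ (λ v → 4 * (1 + j) * (⟦ C? v ⟧ * S-degree v)) _ ⟨
    ∑[ v < order ] (4 * (1 + j) * (⟦ C? v ⟧ * S-degree v) + ⟦ C? v ⟧ * r)
      ≡⟨ sum-cong-≗ (λ v → factor (4 * (1 + j)) ⟦ C? v ⟧ (S-degree v) r) ⟩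
    ∑[ v < order ] (⟦ C? v ⟧ * (4 * (1 + j) * S-degree v + r)) ∎
    where
    open ≤-Reasoning

    factor : ∀ k c s r → k * (c * s) + c * r ≡ c * (k * s + r)
    factor = solve-∀

    bound : 4 * (1 + j) * r ≤ 4 * (1 + j) * ∂C C? closed + ∣C∣ C? closed * r
    bound with Fin.any? (λ v → C? v ×-dec (S-degree v ≟ 0))
    ... | no ¬∃v = ≤-trans
      (*-monoʳ-≤ (4 * (1 + j)) (boundary-large C? closed Cu λ v Cv s≡0 → ¬∃v (v , Cv , s≡0)))
      (m≤m+n _ _)
    ... | yes (v , Cv , s≡0) = begin
      4 * (1 + j) * r
        -- The factor 4 comes from 1 + r² = 4 (r - 1) + 1 + (r - 2)².
        ≤⟨ *-monoˡ-≤ r (≤-trans (m≤m+n _ (1 + j * j)) (≤-reflexive (square j))) ⟩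
      (1 + r * r) * r
        ≤⟨ *-monoˡ-≤ r (volume-large C? closed Cv s≡0) ⟩
      (∣C∣ C? closed + ∂C C? closed) * r
        ≡⟨ expand (∣C∣ C? closed) (∂C C? closed) r ⟩
      r * ∂C C? closed + ∣C∣ C? closed * r
        ≤⟨ +-monoˡ-≤ (∣C∣ C? closed * r) (*-monoˡ-≤ (∂C C? closed)
             (≤-trans (m≤m+n (2 + j) (2 + 3 * j)) (≤-reflexive (4r-4 j)))) ⟩
      4 * (1 + j) * ∂C C? closed + ∣C∣ C? closed * r ∎
      where
      square : ∀ j → 4 * (1 + j) + (1 + j * j) ≡ 1 + (2 + j) * (2 + j)
      square = solve-∀

      expand : ∀ a b r → (a + b) * r ≡ r * b + a * r
      expand = solve-∀

      4r-4 : ∀ j → 2 + j + (2 + 3 * j) ≡ 4 * (1 + j)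
      4r-4 = solve-∀

-- The deficiency bound

module Deficiency (G : Graph) where
  open Simple G
  open Mating
  open Barrier G

  ν : ℕ
  ν = matchingNumber G

  ∅ : V → Bool
  ∅ _ = false

  -- Starts the search for a maximal barrier.
  ∅-barrier : IsBarrier ν ∅
  ∅-barrier M _ = begin
    cov M + 2 * ∣ ∅ ∣ₛ ≡⟨ cong (λ k → cov M + 2 * k) (sum-zero {order} (λ _ → refl)) ⟩
    cov M + 0          ≡⟨ +-identityʳ (cov M) ⟩
    cov M              ≡⟨ cov-even M ⟩
    2 * size M         ≤⟨ *-monoʳ-≤ 2 (size≤matchingNumber M) ⟩
    2 * ν              ∎
    where open ≤-Reasoning

  insert : V → (V → Bool) → V → Bool
  insert v S w = does (w Fin.≟ v) ∨ S w

  ∈-insert : ∀ v S → T (insert v S v)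
  ∈-insert v S with v Fin.≟ v
  ... | yes _  = _
  ... | no v≢v = contradiction refl v≢v

  ⊆-insert : ∀ v S {w} → T (S w) → T (insert v S w)
  ⊆-insert v S {w} w∈S with w Fin.≟ v
  ... | yes _ = _
  ... | no _  = w∈S

  ∣insert∣ : ∀ {v S} → ¬ T (S v) → ∣ insert v S ∣ₛ ≡ 1 + ∣ S ∣ₛ
  ∣insert∣ {v} {S} v∉S = begin
    ∣ insert v S ∣ₛ
      ≡⟨ sum-cong-≗ pointwise ⟩
    ∑[ w < order ] (⟦ w Fin.≟ v ⟧ + ⟦ T? (S w) ⟧)
      ≡⟨ ∑-distrib-+ (λ w → ⟦ w Fin.≟ v ⟧) _ ⟩
    ∑[ w < order ] ⟦ w Fin.≟ v ⟧ + ∣ S ∣ₛ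
      ≡⟨ cong (_+ ∣ S ∣ₛ) (count-≡ v) ⟩
    1 + ∣ S ∣ₛ ∎
    where
    open ≡-Reasoning

    pointwise : ∀ w → ⟦ T? (insert v S w) ⟧ ≡ ⟦ w Fin.≟ v ⟧ + ⟦ T? (S w) ⟧
    pointwise w with w Fin.≟ v
    ... | yes refl = cong suc (sym (⟦⟧-no (T? (S v)) v∉S))
    ... | no _     = refl

  ∣∣ₛ≤order : ∀ S → ∣ S ∣ₛ ≤ order
  ∣∣ₛ≤order S = ≤-trans (sum-mono-≤ (λ v → ⟦⟧≤1 (T? (S v))))
    (≤-reflexive (trans (sum-const order 1) (*-identityʳ order)))

  unmated : Mating
  unmated = record { mate = id ; involutive = λ _ → refl ; mate-adj = λ ≢ → contradiction refl ≢ }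

  module _ {S : V → Bool} (barrier : IsBarrier ν S)
           (maximal : ∀ S′ → IsBarrier ν S′ → ∣ S′ ∣ₛ ≤ ∣ S ∣ₛ) where
    open Tightness G ν S barrier

    -- If every tight matching covered `v`, those that miss `v` would fall short of equality, and
    -- `S` could be enlarged by `v`.
    missable : ∀ {v} → ¬ T (S v) → ¬ ¬ (∃[ M ] Tight M × mate M v ≡ v)
    missable {v} v∉S ¬missed = 1+n≰n (≤-trans (≤-reflexive (sym (∣insert∣ v∉S)))
      (maximal (insert v S) insert-barrier))
      where
      insert-barrier : IsBarrier ν (insert v S)
      insert-barrier M avoids with 2 * ν ≤? cov M + 2 * ∣ S ∣ₛ
      ... | yes tight = contradiction
        (M , ((λ w w∈S → avoids w (⊆-insert v S w∈S)) , tight) , avoids v (∈-insert v S)) ¬missed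
      ... | no ¬tight = begin
        cov M + 2 * ∣ insert v S ∣ₛ
          ≡⟨ cong₂ (λ c k → c + 2 * k) (cov-even M) (∣insert∣ v∉S) ⟩
        2 * size M + 2 * (1 + ∣ S ∣ₛ)
          ≡⟨ collect (size M) ∣ S ∣ₛ ⟩
        2 * suc (size M + ∣ S ∣ₛ)
          -- Both sides of the failed tightness are even, so they differ by at least 2, which is the
          -- room needed for `v`.
          ≤⟨ *-monoʳ-≤ 2 (*-cancelˡ-< 2 (size M + ∣ S ∣ₛ) ν (≤-<-trans (≤-reflexive even) (≰⇒> ¬tight))) ⟩
        2 * ν ∎
        where
        open ≤-Reasoning

        collect : ∀ a b → 2 * a + 2 * (1 + b) ≡ 2 * suc (a + b)
        collect = solve-∀

        even : 2 * (size M + ∣ S ∣ₛ) ≡ cov M + 2 * ∣ S ∣ₛ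
        even = trans (*-distribˡ-+ 2 (size M) ∣ S ∣ₛ) (cong (_+ 2 * ∣ S ∣ₛ) (sym (cov-even M)))

    -- Stands in for the component of `u` in G - S: being closed under adjacency outside `S`, it
    -- contains that component, and no connectivity has to be defined.
    Class : V → V → Set
    Class u v = ¬ T (S v) × (v ≡ u ⊎ ¬ Together u v)

    -- If `u` and `w` were missed together while `v` is missed with neither, Gallai's lemma would
    -- make `v` unmissable.
    class-closed : ∀ {u v w} → Class u v → v ~ w → ¬ T (S w) → Class u w
    class-closed {u} {v} {w} (v∉S , v≈u) v~w w∉S = w∉S , related v≈u
      where
      apart = adjacent⇒¬together v~w v∉S w∉S

      related : v ≡ u ⊎ ¬ Together u v → w ≡ u ⊎ ¬ Together u w
      related (inj₁ refl) = inj₂ apart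
      related (inj₂ ¬uv) with w Fin.≟ u
      ... | yes w≡u = inj₁ w≡u
      ... | no w≢u  = inj₂ λ uw → missable v∉S
        (gallai v (w≢u ∘ sym) uw (¬uv ∘ together-sym) apart)

    -- A common member other than `u` and `u′` is missed with neither of them, so `gallai`
    -- contradicts `missable`.
    class-disjoint : ∀ {u u′ v} → Together u u′ → Class u v → Class u′ v → u ≡ u′
    class-disjoint _   (_ , inj₁ refl) (_ , inj₁ refl) = refl
    class-disjoint uu′ (_ , inj₁ refl) (_ , inj₂ ¬u′v)  =
      contradiction (together-sym uu′) ¬u′v
    class-disjoint uu′ (_ , inj₂ ¬uv)  (_ , inj₁ refl)  = contradiction uu′ ¬uv
    class-disjoint {u} {u′} {v} uu′ (v∉S , inj₂ ¬uv) (_ , inj₂ ¬u′v) with u Fin.≟ u′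
    ... | yes u≡u′ = u≡u′
    ... | no u≢u′  = contradiction
      (gallai v u≢u′ uu′ (¬uv ∘ together-sym) (¬u′v ∘ together-sym))
      (missable v∉S)

    module _ (girth : Girth≥ 5) {j : ℕ} (regular : Regular (2 + j)) where
      open Isoperimetry G girth regular S

      private
        r k : ℕ
        r = 2 + j
        k = 4 * (1 + j)

      ∑-S-degree : ∑[ v < order ] S-degree v ≡ ∣ S ∣ₛ * r
      ∑-S-degree = begin
        ∑[ v < order ] ∑[ w < order ] (⟦ T? (S w) ⟧ * ⟦ v ~? w ⟧)
          ≡⟨ ∑-comm (λ v w → ⟦ T? (S w) ⟧ * ⟦ v ~? w ⟧) ⟩
        ∑[ w < order ] ∑[ v < order ] (⟦ T? (S w) ⟧ * ⟦ v ~? w ⟧)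
          ≡⟨ sum-cong-≗ (λ w → *-distribˡ-sum ⟦ T? (S w) ⟧ (λ v → ⟦ v ~? w ⟧)) ⟨
        ∑[ w < order ] (⟦ T? (S w) ⟧ * ∑[ v < order ] ⟦ v ~? w ⟧)
          ≡⟨ sum-cong-≗ (λ w → cong (⟦ T? (S w) ⟧ *_)
               (trans (sum-cong-≗ λ v → cong (λ b → ⟦ T? b ⟧) (symm v w)) (∑-adj w))) ⟩
        ∑[ w < order ] (⟦ T? (S w) ⟧ * r)
          ≡⟨ *-distribʳ-sum r (λ w → ⟦ T? (S w) ⟧) ⟨
        ∣ S ∣ₛ * r ∎
        where open ≡-Reasoning

      module _ (together? : ∀ u v → Dec (Together u v))
               {M : Mating} (M-tight : Tight M) where

        Exposed : V → Set
        Exposed u = ¬ T (S u) × mate M u ≡ u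

        exposed? : Decidable Exposed
        exposed? u = ¬? (T? (S u)) ×-dec fixed? M u

        class? : ∀ u → Decidable (Class u)
        class? u v = ¬? (T? (S v)) ×-dec ((v Fin.≟ u) ⊎-dec ¬? (together? u v))

        ∣E∣ : ℕ
        ∣E∣ = ∑[ u < order ] ⟦ exposed? u ⟧

        weight : V → ℕ
        weight v = k * S-degree v + r

        -- The classes of the exposed nodes are disjoint and each weighs at least `k * r`, whereas
        -- all nodes together weigh `k * ∣ S ∣ₛ * r + order * r`.
        exposed-bound : k * ∣E∣ ≤ k * ∣ S ∣ₛ + order
        exposed-bound = *-cancelʳ-≤ _ _ r (begin
          k * ∣E∣ * r
            ≡⟨ rotate k ∣E∣ r ⟩
          ∣E∣ * (k * r)
            ≡⟨ *-distribʳ-sum (k * r) (λ u → ⟦ exposed? u ⟧) ⟩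
          ∑[ u < order ] (⟦ exposed? u ⟧ * (k * r))
            ≤⟨ sum-mono-≤ (λ u → ⟦⟧*-mono (exposed? u) λ (u∉S , _) →
                 isoperimetry refl (class? u) class-closed (u∉S , inj₁ refl)) ⟩
          ∑[ u < order ] (⟦ exposed? u ⟧ * ∑[ v < order ] (⟦ class? u v ⟧ * weight v))
            ≤⟨ packing exposed? class?
                 (λ (_ , Mu) Cu (_ , Mu′) Cu′ → class-disjoint (M , M-tight , Mu , Mu′) Cu Cu′) weight ⟩
          ∑[ v < order ] (k * S-degree v + r)
            ≡⟨ ∑-distrib-+ (λ v → k * S-degree v) _ ⟩
          ∑[ v < order ] (k * S-degree v) + ∑[ v < order ] r
            ≡⟨ cong₂ _+_ (sym (*-distribˡ-sum k S-degree)) (sum-const order r) ⟩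
          k * ∑[ v < order ] S-degree v + order * r
            ≡⟨ cong (λ s → k * s + order * r) ∑-S-degree ⟩
          k * (∣ S ∣ₛ * r) + order * r
            ≡⟨ collect k ∣ S ∣ₛ r order ⟩
          (k * ∣ S ∣ₛ + order) * r ∎)
          where
          open ≤-Reasoning

          rotate : ∀ a b c → a * b * c ≡ b * (a * c)
          rotate = solve-∀

          collect : ∀ a b c d → a * (b * c) + d * c ≡ (a * b + d) * c
          collect = solve-∀

        partition : order ≡ ∣ S ∣ₛ + ∣E∣ + cov M
        partition = begin
          order
            ≡⟨ trans (sum-const order 1) (*-identityʳ order) ⟨
          ∑[ v < order ] 1
            ≡⟨ sum-cong-≗ one ⟩
          ∑[ v < order ] (⟦ T? (S v) ⟧ + ⟦ exposed? v ⟧ + ⟦ covered? M v ⟧)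
            ≡⟨ ∑-distrib-+₃ (λ v → ⟦ T? (S v) ⟧) _ _ ⟩
          ∣ S ∣ₛ + ∣E∣ + cov M ∎
          where
          open ≡-Reasoning

          one : ∀ v → 1 ≡ ⟦ T? (S v) ⟧ + ⟦ exposed? v ⟧ + ⟦ covered? M v ⟧
          one v with T? (S v)
          ... | yes v∈S = cong suc (sym (⟦⟧-no (covered? M v) λ ≢ → ≢ (proj₁ M-tight v v∈S)))
          ... | no _ with fixed? M v
          ...   | yes _ = refl
          ...   | no _  = refl

        tight-bound : k * order ≤ k * (2 * ν) + order
        tight-bound = begin
          k * order
            ≡⟨ cong (k *_) partition ⟩
          k * (∣ S ∣ₛ + ∣E∣ + cov M)
            ≡⟨ pull k ∣ S ∣ₛ ∣E∣ (cov M) ⟩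
          k * (∣ S ∣ₛ + cov M) + k * ∣E∣
            ≤⟨ +-monoʳ-≤ (k * (∣ S ∣ₛ + cov M)) exposed-bound ⟩
          k * (∣ S ∣ₛ + cov M) + (k * ∣ S ∣ₛ + order)
            ≡⟨ push k ∣ S ∣ₛ (cov M) order ⟩
          k * (cov M + 2 * ∣ S ∣ₛ) + order
            ≤⟨ +-monoˡ-≤ order (*-monoʳ-≤ k (barrier M (proj₁ M-tight))) ⟩
          k * (2 * ν) + order ∎
          where
          open ≤-Reasoning

          pull : ∀ k a b c → k * (a + b + c) ≡ k * (a + c) + k * b
          pull = solve-∀

          push : ∀ k a c n → k * (a + c) + (k * a + n) ≡ k * (c + 2 * a) + n
          push = solve-∀

  -- Covers the case in which no node outside `S` is left to supply a tight matching; here the empty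
  -- matching avoids `S`.
  full-bound : ∀ {S} → IsBarrier ν S → (∀ v → T (S v)) → order ≤ 2 * ν
  full-bound {S} barrier full = begin
    order
      ≡⟨ trans (sum-const order 1) (*-identityʳ order) ⟨
    ∑[ v < order ] 1
      ≡⟨ sum-cong-≗ (λ v → sym (⟦⟧-yes (T? (S v)) (full v))) ⟩
    ∣ S ∣ₛ
      ≤⟨ m≤m+n ∣ S ∣ₛ _ ⟩
    2 * ∣ S ∣ₛ
      ≤⟨ m≤n+m _ (cov unmated) ⟩
    cov unmated + 2 * ∣ S ∣ₛ
      ≤⟨ barrier unmated (λ _ _ → refl) ⟩
    2 * ν ∎
    where open ≤-Reasoning

  deficiency : Girth≥ 5 → ∀ {j} → Regular (2 + j) →
               4 * (1 + j) * order ≤ 4 * (1 + j) * (2 * ν) + order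
  deficiency girth {j} regular = decidable-stable (_ ≤? _) λ ¬bound →
    ¬¬-maximal (IsBarrier ν) ∣_∣ₛ order ∣∣ₛ≤order {∅} ∅-barrier λ (S , barrier , maximal) →
    -- `Together` asks for a mating, but only finitely many instances occur, so all of them may be
    -- taken as decided.
    ¬¬-∀Fin (λ u → ¬¬-∀Fin λ v →
      ¬¬-excluded-middle {A = Tightness.Together G ν S barrier u v}) λ together? →
    -- A node outside `S` would give a tight matching and hence the bound; so `S` contains every
    -- node.
    ¬bound (≤-trans
      (*-monoʳ-≤ (4 * (1 + j)) (full-bound barrier λ v → decidable-stable (T? (S v)) λ v∉S →
        missable barrier maximal v∉S λ (M , tight , _) →
          ¬bound (tight-bound barrier maximal girth regular together? {M} tight)))
      (m≤m+n _ order))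

-- The bound in ℚ

[m*n]^o≡m^o*n^o : ∀ m n o → (m * n) ℕ.^ o ≡ m ℕ.^ o * n ℕ.^ o
[m*n]^o≡m^o*n^o m n zero    = refl
[m*n]^o≡m^o*n^o m n (suc o) = trans (cong (m * n *_) ([m*n]^o≡m^o*n^o m n o))
  (interchange m n (m ℕ.^ o) (n ℕ.^ o))
  where
  interchange : ∀ a b c d → a * b * (c * d) ≡ a * c * (b * d)
  interchange = solve-∀

n<2^n : ∀ n → n < 2 ℕ.^ n
n<2^n zero    = s≤s z≤n
n<2^n (suc n) = ≤-trans (+-mono-≤ (m^n>0 2 n) (n<2^n n))
  (≤-reflexive (cong (2 ℕ.^ n +_) (sym (+-identityʳ (2 ℕ.^ n)))))

-- Here s = r - 3. It amounts to (r - 1)² ≤ 4^(r - 2), the square of r - 1 ≤ 2^(r - 2).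
[r-1]^r≤[4[r-1]]^[r-2] : ∀ s → (2 + s) ℕ.^ (3 + s) ≤ (4 * (2 + s)) ℕ.^ (1 + s)
[r-1]^r≤[4[r-1]]^[r-2] s = begin
  p * (p * p ℕ.^ d)           ≡⟨ *-assoc p p (p ℕ.^ d) ⟨
  p * p * p ℕ.^ d             ≤⟨ *-monoˡ-≤ (p ℕ.^ d) (*-mono-≤ (n<2^n d) (n<2^n d)) ⟩
  2 ℕ.^ d * 2 ℕ.^ d * p ℕ.^ d ≡⟨ cong (_* p ℕ.^ d) ([m*n]^o≡m^o*n^o 2 2 d) ⟨
  4 ℕ.^ d * p ℕ.^ d           ≡⟨ [m*n]^o≡m^o*n^o 4 p d ⟨
  (4 * p) ℕ.^ d               ∎
  where
  open ≤-Reasoning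
  p = 2 + s
  d = 1 + s

-- Natural numbers and fractions in ℚ

open import Data.Integer.Base using (+_; -[1+_])

ι : ℕ → ℚ
ι m = + m / 1

-- Passing to unnormalised fractions avoids the gcd in `/`, so identities reduce to
-- cross-multiplication.
toℚᵘ-/ : ∀ m d .{{_ : NonZero d}} → toℚᵘ (+ m / d) ℚᵘ.≃ + m /ᵘ d
toℚᵘ-/ m (suc d) = ℚ.toℚᵘ-fromℚᵘ (+ m /ᵘ suc d)

ι-* : ∀ m n → ι (m * n) ≡ ι m ℚ.* ι n
ι-* m n = ℚ.toℚᵘ-injective (begin
  toℚᵘ (ι (m * n))           ≈⟨ toℚᵘ-/ (m * n) 1 ⟩
  + (m * n) /ᵘ 1             ≈⟨ ℚᵘ.*≡* (cong (ℤ._* + 1) (ℤ.pos-* m n)) ⟩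
  (+ m /ᵘ 1) ℚᵘ.* (+ n /ᵘ 1) ≈⟨ ℚᵘ.*-cong (toℚᵘ-/ m 1) (toℚᵘ-/ n 1) ⟨
  toℚᵘ (ι m) ℚᵘ.* toℚᵘ (ι n) ≈⟨ ℚ.toℚᵘ-homo-* (ι m) (ι n) ⟨
  toℚᵘ (ι m ℚ.* ι n)         ∎)
  where open ℚᵘ.≃-Reasoning

ι-+ : ∀ m n → ι (m + n) ≡ ι m ℚ.+ ι n
ι-+ m n = ℚ.toℚᵘ-injective (begin
  toℚᵘ (ι (m + n))           ≈⟨ toℚᵘ-/ (m + n) 1 ⟩
  + (m + n) /ᵘ 1             ≈⟨ ℚᵘ.*≡* (cong (ℤ._* + 1)
                                  (sym (cong₂ ℤ._+_ (ℤ.*-identityʳ (+ m)) (ℤ.*-identityʳ (+ n))))) ⟩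
  (+ m /ᵘ 1) ℚᵘ.+ (+ n /ᵘ 1) ≈⟨ ℚᵘ.+-cong (toℚᵘ-/ m 1) (toℚᵘ-/ n 1) ⟨
  toℚᵘ (ι m) ℚᵘ.+ toℚᵘ (ι n) ≈⟨ ℚ.toℚᵘ-homo-+ (ι m) (ι n) ⟨
  toℚᵘ (ι m ℚ.+ ι n)         ∎)
  where open ℚᵘ.≃-Reasoning

ι-/ : ∀ m n .{{_ : NonZero n}} → ι n ℚ.* (+ m / n) ≡ ι m
ι-/ m n@(suc _) = ℚ.toℚᵘ-injective (begin
  toℚᵘ (ι n ℚ.* (+ m / n))       ≈⟨ ℚ.toℚᵘ-homo-* (ι n) (+ m / n) ⟩
  toℚᵘ (ι n) ℚᵘ.* toℚᵘ (+ m / n) ≈⟨ ℚᵘ.*-cong (toℚᵘ-/ n 1) (toℚᵘ-/ m n) ⟩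
  (+ n /ᵘ 1) ℚᵘ.* (+ m /ᵘ n)     ≈⟨ ℚᵘ.*≡* (trans (ℤ.*-identityʳ (+ n ℤ.* + m))
                                      (trans (ℤ.*-comm (+ n) (+ m)) (cong (λ k → + m ℤ.* + k) (sym (*-identityˡ n))))) ⟩
  + m /ᵘ 1   ≈⟨ toℚᵘ-/ m 1 ⟨
  toℚᵘ (ι m) ∎)
  where open ℚᵘ.≃-Reasoning

ι-mono-≤ : ∀ {m n} → m ≤ n → ι m ℚ.≤ ι n
ι-mono-≤ {m} {n} m≤n = ℚ.toℚᵘ-cancel-≤ (begin
  toℚᵘ (ι m) ≃⟨ toℚᵘ-/ m 1 ⟩
  + m /ᵘ 1   ≤⟨ ℚᵘ.*≤* (ℤ.*-monoʳ-≤-nonNeg (+ 1) (ℤ.+≤+ m≤n)) ⟩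
  + n /ᵘ 1   ≃⟨ toℚᵘ-/ n 1 ⟨
  toℚᵘ (ι n) ∎)
  where open ℚᵘ.≤-Reasoning

ι-^ : ∀ m n → ι (m ℕ.^ n) ≡ ι m ^ n
ι-^ m zero    = refl
ι-^ m (suc n) = trans (ι-* m (m ℕ.^ n)) (cong (ι m ℚ.*_) (ι-^ m n))

ι-nonNeg : ∀ n → ℚ.NonNegative (ι n)
ι-nonNeg n = ℚ.normalize-nonNeg n 1

ι-pos : ∀ n .{{_ : NonZero n}} → ℚ.Positive (ι n)
ι-pos n = ℚ.normalize-pos n 1

^-nonNeg : ∀ n {x} → 0ℚ ℚ.≤ x → 0ℚ ℚ.≤ x ^ n
^-nonNeg zero        0≤x = ℚ.nonNegative⁻¹ 1ℚ
^-nonNeg (suc n) {x} 0≤x = ℚ.nonNegative⁻¹ (x ℚ.* x ^ n)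
  {{ℚ.nonNeg*nonNeg⇒nonNeg x {{ℚ.nonNegative 0≤x}} (x ^ n) {{ℚ.nonNegative (^-nonNeg n 0≤x)}}}}

^≤1 : ∀ n {x} → 0ℚ ℚ.≤ x → x ℚ.≤ 1ℚ → x ^ n ℚ.≤ 1ℚ
^≤1 zero        0≤x x≤1 = ℚ.≤-refl
^≤1 (suc n) {x} 0≤x x≤1 = begin
  x ℚ.* x ^ n ≤⟨ ℚ.*-monoˡ-≤-nonNeg x {{ℚ.nonNegative 0≤x}} (^≤1 n 0≤x x≤1) ⟩
  x ℚ.* 1ℚ    ≡⟨ ℚ.*-identityʳ x ⟩
  x           ≤⟨ x≤1 ⟩
  1ℚ          ∎
  where open ℚ.≤-Reasoning

^<1 : ∀ n {x} → 0ℚ ℚ.≤ x → x ℚ.< 1ℚ → x ^ suc n ℚ.< 1ℚ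
^<1 n {x} 0≤x x<1 = begin-strict
  x ℚ.* x ^ n ≤⟨ ℚ.*-monoˡ-≤-nonNeg x {{ℚ.nonNegative 0≤x}} (^≤1 n 0≤x (ℚ.<⇒≤ x<1)) ⟩
  x ℚ.* 1ℚ    ≡⟨ ℚ.*-identityʳ x ⟩
  x           <⟨ x<1 ⟩
  1ℚ          ∎
  where open ℚ.≤-Reasoning

-- From the deficiency bound to the Dedekind cut

module _ (k n ν : ℕ) .{{_ : NonZero k}} .{{_ : NonZero n}}
         (bound : k * n ≤ k * (2 * ν) + n) where

  -- For x above ν / n, the number 1 - 2x is below (n - 2ν) / n, which is at most 1 / k.
  scaled-deficiency<1 : ∀ {x} → + ν / n ℚ.< x → (1ℚ ℚ.- (x ℚ.+ x)) ℚ.* ι k ℚ.< 1ℚ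
  scaled-deficiency<1 {x} ν/n<x = ℚ.*-cancelˡ-<-nonNeg (ι n) {{ι-nonNeg n}} (begin-strict
    ι n ℚ.* ((1ℚ ℚ.- (x ℚ.+ x)) ℚ.* ι k)
      ≡⟨ solve 3 (λ N K x → N :* ((con 1ℚ :- (x :+ x)) :* K) := K :* N :- K :* (N :* x :+ N :* x))
           refl (ι n) (ι k) x ⟩
    ι k ℚ.* ι n ℚ.- ι k ℚ.* (ι n ℚ.* x ℚ.+ ι n ℚ.* x)
      <⟨ ℚ.+-mono-≤-< bound′ (ℚ.neg-antimono-< (ℚ.*-monoʳ-<-pos (ι k) {{ι-pos k}} (ℚ.+-mono-< ν<nx ν<nx))) ⟩
    ι k ℚ.* (ι ν ℚ.+ ι ν) ℚ.+ ι n ℚ.- ι k ℚ.* (ι ν ℚ.+ ι ν)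
      ≡⟨ solve 2 (λ A N → (A :+ N) :- A := N :* con 1ℚ) refl (ι k ℚ.* (ι ν ℚ.+ ι ν)) (ι n) ⟩
    ι n ℚ.* 1ℚ ∎)
    where
    open ℚ.≤-Reasoning

    bound′ : ι k ℚ.* ι n ℚ.≤ ι k ℚ.* (ι ν ℚ.+ ι ν) ℚ.+ ι n
    bound′ = begin
      ι k ℚ.* ι n                   ≡⟨ ι-* k n ⟨
      ι (k * n)                     ≤⟨ ι-mono-≤ bound ⟩
      ι (k * (2 * ν) + n)           ≡⟨ ι-+ (k * (2 * ν)) n ⟩
      ι (k * (2 * ν)) ℚ.+ ι n       ≡⟨ cong (ℚ._+ ι n) (ι-* k (2 * ν)) ⟩
      ι k ℚ.* ι (2 * ν) ℚ.+ ι n     ≡⟨ cong (λ m → ι k ℚ.* ι (ν + m) ℚ.+ ι n) (+-identityʳ ν) ⟩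
      ι k ℚ.* ι (ν + ν) ℚ.+ ι n     ≡⟨ cong (λ y → ι k ℚ.* y ℚ.+ ι n) (ι-+ ν ν) ⟩
      ι k ℚ.* (ι ν ℚ.+ ι ν) ℚ.+ ι n ∎

    ν<nx : ι ν ℚ.< ι n ℚ.* x
    ν<nx = subst (ℚ._< ι n ℚ.* x) (ι-/ ν n) (ℚ.*-monoʳ-<-pos (ι n) {{ι-pos n}} ν/n<x)

-- From y < 1 / (4 (r - 1)) follows y^(r - 2) < (4 (r - 1))^(2 - r) ≤ (r - 1)^(-r); hence y lies
-- below the root in the statement.
root-bound : ∀ s {y} → 0ℚ ℚ.≤ y → y ℚ.* ι (4 * (2 + s)) ℚ.< 1ℚ →
             y ^ (1 + s) ℚ.< (2 + s) ^ℤ -[1+ 2 + s ]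
root-bound s {y} 0≤y yK<1 = ℚ.*-cancelˡ-<-nonNeg (ι B) {{ι-nonNeg B}} (begin-strict
  ι B ℚ.* y ^ d
    ≤⟨ ℚ.*-monoʳ-≤-nonNeg (y ^ d) {{ℚ.nonNegative (^-nonNeg d 0≤y)}} (ι-mono-≤ ([r-1]^r≤[4[r-1]]^[r-2] s)) ⟩
  ι (K ℕ.^ d) ℚ.* y ^ d
    ≡⟨ ℚ.*-comm (ι (K ℕ.^ d)) (y ^ d) ⟩
  y ^ d ℚ.* ι (K ℕ.^ d)
    ≡⟨ cong (y ^ d ℚ.*_) (ι-^ K d) ⟩
  y ^ d ℚ.* ι K ^ d
    ≡⟨ ^-distrib-* y (ι K) d ⟨
  (y ℚ.* ι K) ^ d
    <⟨ ^<1 s (ℚ.nonNegative⁻¹ (y ℚ.* ι K)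
         {{ℚ.nonNeg*nonNeg⇒nonNeg y {{ℚ.nonNegative 0≤y}} (ι K) {{ι-nonNeg K}}}}) yK<1 ⟩
  1ℚ
    ≡⟨ ι-/ 1 B ⟨
  ι B ℚ.* ((2 + s) ^ℤ -[1+ 2 + s ]) ∎)
  where
  open ℚ.≤-Reasoning
  d = 1 + s
  K = 4 * (2 + s)
  B = (2 + s) ℕ.^ (3 + s)
  instance _ = m^n≢0 (2 + s) (3 + s)

/-nonNeg : ∀ m n .{{_ : NonZero n}} → 0ℚ ℚ.≤ + m / n
/-nonNeg m n = ℚ.nonNegative⁻¹ (+ m / n) {{ℚ.normalize-nonNeg m n}}

-- Subtraction from 1 swaps the two cuts: the claim unfolds to the lower cut of the root at `y`,
-- which holds every negative number, so `root-bound` is called only for `y` at least 0.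
upper-cut : ∀ s E q → let y = 1ℚ ℚ.- ((q ℚ.+ E) ℚ.+ (q ℚ.+ E)) in
          y ℚ.< 0ℚ ⊎ y ℚ.* ι (4 * (2 + s)) ℚ.< 1ℚ →
          ℝ.U ((1ℚ ℚ- (2 + s) ^ℚ (-ᵘ (+ (3 + s) /ᵘ (1 + s)))) /2 -ℚ E) q
upper-cut s E q (inj₁ y<0)  = inj₁ y<0
upper-cut s E q (inj₂ yK<1) with 1ℚ ℚ.- ((q ℚ.+ E) ℚ.+ (q ℚ.+ E)) ℚ.<? 0ℚ
... | yes y<0 = inj₁ y<0
... | no y≮0  = inj₂ (root-bound s (ℚ.≮⇒≥ y≮0) yK<1)

1-2x<0 : ∀ {x} → 1ℚ ℚ.< x → 1ℚ ℚ.- (x ℚ.+ x) ℚ.< 0ℚ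
1-2x<0 {x} 1<x = begin-strict
  1ℚ ℚ.- (x ℚ.+ x)   <⟨ ℚ.+-monoʳ-< 1ℚ (ℚ.neg-antimono-< (ℚ.+-mono-< 1<x 1<x)) ⟩
  1ℚ ℚ.- (1ℚ ℚ.+ 1ℚ) <⟨ ℚ.negative⁻¹ (1ℚ ℚ.- (1ℚ ℚ.+ 1ℚ)) ⟩
  0ℚ                 ∎
  where open ℚ.≤-Reasoning

corollary6 : (g r : ℕ) → 4 ≤ g → (3≤r : 3 ≤ r) →
  let k = (g ∸ 2) div 2
      instance r-2≢0 = ℕ.>-nonZero (m<n⇒0<n∸m 3≤r)
      instance r-1≢0 = ℕ.>-nonZero (m<n⇒0<n∸m (≤-trans (n≤1+n 2) 3≤r))
      instance k!≢0  = k !≢0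
  in  (1ℚ ℚ- (r ∸ 1) ^ℚ (-ᵘ (+ r /ᵘ (r ∸ 2)))) /2
        -ℚ (+ (r ℕ.* (r ∸ 1) ℕ.^ k) / (k !))
      ≤ᴿ inf (λ (G : 𝒢 g r) → matchingRatio G)
corollary6 g r@(suc (suc (suc s))) 4≤g 3≤r@(s≤s (s≤s (s≤s z≤n))) q (G , ratio<q) =
  -- A rational above the infimum is above the ratio of a single graph `G`, so only `G` has to be
  -- considered.
  upper-cut s E q (by-girth (m≤n⇒m<n∨m≡n 4≤g))
  where
  open 𝒢 G
  k = (g ∸ 2) div 2
  instance
    _ = nonEmpty
    _ = k !≢0

  E : ℚ
  E = + (r * (r ∸ 1) ℕ.^ k) / (k !)

  by-girth : 4 < g ⊎ 4 ≡ g →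
             1ℚ ℚ.- ((q ℚ.+ E) ℚ.+ (q ℚ.+ E)) ℚ.< 0ℚ ⊎
             (1ℚ ℚ.- ((q ℚ.+ E) ℚ.+ (q ℚ.+ E))) ℚ.* ι (4 * (2 + s)) ℚ.< 1ℚ
  -- The error term is dropped: as `E` is nonnegative, `q ℚ.+ E` is above the ratio as well.
  by-girth (inj₁ 5≤g)  = inj₂ (scaled-deficiency<1 (4 * (2 + s)) order (matchingNumber graph)
    (Deficiency.deficiency graph (λ v vs cycle → ≤-trans 5≤g (girth v vs cycle)) regular)
    (ℚ.<-≤-trans ratio<q (subst (ℚ._≤ q ℚ.+ E) (ℚ.+-identityʳ q)
      (ℚ.+-monoʳ-≤ q (/-nonNeg (r * (r ∸ 1) ℕ.^ k) (k !))))))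
  -- For g = 4 the error term is r (r - 1) / 1!, at least 1, and the ratio is nonnegative, so
  -- `q ℚ.+ E` exceeds 1.
  by-girth (inj₂ refl) = inj₁ (1-2x<0 (ℚ.+-mono-<-≤
    (ℚ.≤-<-trans (/-nonNeg (matchingNumber graph) order) ratio<q)
    (ι-mono-≤ {1} {r * (r ∸ 1) ℕ.^ 1} (s≤s z≤n))))
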